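{- Let $G$ be a maximally edge-connected graph of order $m\geq 5$ with $\delta(G)\geq 2$, and let $n\geq 4$. Then $$\lambda_3(G\boxtimes C_n)=\xi_3(G\boxtimes C_n)=\begin{cases}9\delta(G), & \text{if } \xi(G)=2\delta(G)-2;\\ 9\delta(G)+2, & \text{otherwise.}\end{cases}$$ That is, $G\boxtimes C_n$ is maximally 3-restricted edge-connected.
   Context: Graphs are finite and simple. The order of $G$ is $|V(G)|$; $d_G(u)$ is the degree of $u$, and $\delta(G)$ is the minimum degree of $G$. $C_n$ is the cycle of order $n$. An edge subset $S\subseteq E(G)$ is an edge-cut if $G-S$ is disconnected; the edge-connectivity $\lambda(G)$ is the minimum cardinality of an edge-cut. $G$ is maximally edge-connected if $\lambda(G)=\delta(G)$. For an edge $e=uv\in E(G)$, its edge-degree is $\xi_G(e)=d_G(u)+d_G(v)-2$, and $\xi(G)=\min\{\xi_G(e) : e\in E(G)\}$. An edge subset $S\subseteq E(G)$ is a 3-restricted edge-cut if $G-S$ is disconnected and each component of $G-S$ has at least three vertices. $\lambda_3(G)$ is the minimum cardinality of a 3-restricted edge-cut of $G$ if one exists, and $\lambda_3(G)=+\infty$ otherwise. For $X\subseteq V(G)$, $\partial_G(X)$ is the set of edges with one endpoint in $X$ and the other in $V(G)\setminus X$, and $\xi_3(G)=\min\{|\partial_G(X)| : X\subseteq V(G),\ |X|=3,\ G[X]\text{ is connected}\}$. $G$ is maximally 3-restricted edge-connected if $\lambda_3(G)=\xi_3(G)$. The strong product $G\boxtimes H$ has vertex set $V(G)\times V(H)$;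 two distinct vertices $(x_1,y_1)$, $(x_2,y_2)$ are adjacent iff $x_1=x_2$ and $y_1y_2\in E(H)$, or $y_1=y_2$ and $x_1x_2\in E(G)$, or $x_1x_2\in E(G)$ and $y_1y_2\in E(H)$. -}

module Defs where

open import Data.Bool using (Bool; T; _xor_)
open import Data.Bool.Properties using (T?)
open import Data.Fin using (Fin; toℕ)
open import Data.Fin.Properties using () renaming (_≟_ to _≟ᶠ_)
open import Data.List using (List; []; _∷_; _++_; map; length; filter; allFin; cartesianProduct)
open import Data.List.Membership.Propositional using (_∈_)
open import Data.List.Membership.Propositional.Properties
  using (∈-allFin; ∈-cartesianProduct⁺)
open import Data.List.Relation.Unary.All using (All)
open import Data.List.Relation.Unary.Unique.Propositional using (Unique)
open import Data.List.Relation.Unary.Unique.Propositional.Properties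
  using (allFin⁺; cartesianProduct⁺)
open import Data.Nat using (ℕ; suc; _+_; _∸_; _≤_; s≤s) renaming (_≟_ to _≟ⁿ_)
open import Data.Nat.Properties using (1+n≢n)
open import Data.Product using (Σ; ∃; ∃₂; _×_; _,_; proj₁; proj₂; uncurry)
open import Data.Product.Properties using (≡-dec)
open import Data.Sum using (_⊎_; inj₁; inj₂; swap)
open import Function using (_on_; _∘_)
open import Level using (0ℓ)
open import Relation.Binary using (Rel; Decidable; DecidableEquality; Symmetric)
open import Relation.Binary.Construct.Closure.ReflexiveTransitive using (Star)
open import Relation.Binary.PropositionalEquality using (_≡_; refl; sym; trans; cong)
open import Relation.Nullary using (¬_; _×-dec_; _⊎-dec_)
open import Relation.Nullary.Construct.Add.Supremum using (_⁺; ⊤⁺; [_])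

-- Finiteness of the vertex type is witnessed by a duplicate-free list of all
-- vertices.
record Graph : Set₁ where
  field
    V        : Set
    _≟_      : DecidableEquality V
    vertices : List V
    unique   : Unique vertices
    complete : ∀ v → v ∈ vertices
    Adj      : Rel V 0ℓ
    adj?     : Decidable Adj
    adj-sym  : Symmetric Adj
    irrefl   : ∀ {v} → ¬ Adj v v

  order : ℕ
  order = length vertices

  degree : V → ℕ
  degree u = length (filter (adj? u) vertices)

  Edge : Set
  Edge = ∃₂ Adj

  -- For adjacent u and v both degrees are positive, so the truncated
  -- subtraction is exact.
  edgeDegree : Edge → ℕ
  edgeDegree (u , v , _) = degree u + degree v ∸ 2

open Graph using (V; order; Edge; degree; edgeDegree)

-- On a duplicate-free list, every unordered pair of distinct entries occurs
-- exactly once, in one of its two orders.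
pairs : {A : Set} → List A → List (A × A)
pairs []       = []
pairs (x ∷ xs) = map (x ,_) xs ++ pairs xs

IsMinimum : {A : Set} → (A → ℕ) → ℕ → Set
IsMinimum f k = (∃ λ a → f a ≡ k) × (∀ a → k ≤ f a)

-- The minimum over an empty index type is +∞, written ⊤⁺.
IsMinimum∞ : {A : Set} → (A → ℕ) → ℕ ⁺ → Set
IsMinimum∞     f [ k ] = IsMinimum f k
IsMinimum∞ {A} f ⊤⁺    = ¬ A

Connected : {A : Set} → Rel A 0ℓ → Set
Connected R = ∀ u v → Star R u v

AtLeast : {A : Set} → ℕ → (A → Set) → Set
AtLeast k P = ∃ λ xs → Unique xs × All P xs × k ≤ length xs

-- The components of a graph are the sets { v | v reachable from u }.
ComponentsAtLeast : {A : Set} → ℕ → Rel A 0ℓ → Set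
ComponentsAtLeast k R = ∀ u → AtLeast k (Star R u)

module _ (G : Graph) where
  open Graph G hiding (V; order; Edge; degree; edgeDegree)

  -- A set of undirected edges, as a symmetric relation contained in Adj.
  record EdgeSet : Set where
    field
      mem     : V G → V G → Bool
      mem-sym : ∀ {u v} → T (mem u v) → T (mem v u)
      mem-adj : ∀ {u v} → T (mem u v) → Adj u v

  open EdgeSet

  edgeCount : {R : Rel (V G) 0ℓ} → Decidable R → ℕ
  edgeCount R? = length (filter (uncurry R?) (pairs vertices))

  size : EdgeSet → ℕ
  size S = edgeCount (λ u v → T? (mem S u v))

  -- Adjacency in G - S.
  Without : EdgeSet → Rel (V G) 0ℓ
  Without S u v = Adj u v × ¬ T (mem S u v)

  EdgeCut : Set
  EdgeCut = Σ EdgeSet λ S → ¬ Connected (Without S)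

  RestrictedEdgeCut : ℕ → Set
  RestrictedEdgeCut k = Σ EdgeSet λ S →
    ¬ Connected (Without S) × ComponentsAtLeast k (Without S)

  VertexSet : Set
  VertexSet = V G → Bool

  card : VertexSet → ℕ
  card X = length (filter (T? ∘ X) vertices)

  -- Adjacency in the induced subgraph G[X].
  Induced : (X : VertexSet) → Rel (Σ (V G) (T ∘ X)) 0ℓ
  Induced X = Adj on proj₁

  -- |∂(X)|
  boundarySize : VertexSet → ℕ
  boundarySize X = edgeCount (λ u v → adj? u v ×-dec T? (X u xor X v))

  ConnectedSet : ℕ → Set
  ConnectedSet k = Σ VertexSet λ X → card X ≡ k × Connected (Induced X)

  -- The numerical invariants are relations: "G has value k".
  IsMinDegree : ℕ → Set
  IsMinDegree = IsMinimum (degree G)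

  IsMinEdgeDegree : ℕ → Set
  IsMinEdgeDegree = IsMinimum (edgeDegree G)

  IsEdgeConnectivity : ℕ → Set
  IsEdgeConnectivity = IsMinimum {EdgeCut} (size ∘ proj₁)

  Isλ₃ : ℕ ⁺ → Set
  Isλ₃ = IsMinimum∞ {RestrictedEdgeCut 3} (size ∘ proj₁)

  Isξ₃ : ℕ → Set
  Isξ₃ = IsMinimum {ConnectedSet 3} (boundarySize ∘ proj₁)

  MaximallyEdgeConnected : Set
  MaximallyEdgeConnected = ∃ λ k → IsEdgeConnectivity k × IsMinDegree k

  Maximally3RestrictedEdgeConnected : Set
  Maximally3RestrictedEdgeConnected = ∃ λ k → Isλ₃ [ k ] × Isξ₃ k

-- Distinctness of adjacent vertices follows from irreflexivity of G and H.
infixl 7 _⊠_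
_⊠_ : Graph → Graph → Graph
G ⊠ H = record
  { V        = V G × V H
  ; _≟_      = ≡-dec G._≟_ H._≟_
  ; vertices = cartesianProduct G.vertices H.vertices
  ; unique   = cartesianProduct⁺ G.unique H.unique
  ; complete = λ (x , y) → ∈-cartesianProduct⁺ (G.complete x) (H.complete y)
  ; Adj      = λ (x₁ , y₁) (x₂ , y₂) →
                   (x₁ ≡ x₂ × H.Adj y₁ y₂)
                 ⊎ (y₁ ≡ y₂ × G.Adj x₁ x₂)
                 ⊎ (G.Adj x₁ x₂ × H.Adj y₁ y₂)
  ; adj?     = λ (x₁ , y₁) (x₂ , y₂) →
                       (x₁ G.≟ x₂ ×-dec H.adj? y₁ y₂)
                 ⊎-dec (y₁ H.≟ y₂ ×-dec G.adj? x₁ x₂)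
                 ⊎-dec (G.adj? x₁ x₂ ×-dec H.adj? y₁ y₂)
  ; adj-sym  = λ { (inj₁ (p , b))        → inj₁ (sym p , H.adj-sym b)
                 ; (inj₂ (inj₁ (q , a))) → inj₂ (inj₁ (sym q , G.adj-sym a))
                 ; (inj₂ (inj₂ (a , b))) → inj₂ (inj₂ (G.adj-sym a , H.adj-sym b)) }
  ; irrefl   = λ { (inj₁ (_ , b))        → H.irrefl b
                 ; (inj₂ (inj₁ (_ , a))) → G.irrefl a
                 ; (inj₂ (inj₂ (a , _))) → G.irrefl a }
  }
  where
  module G = Graph G
  module H = Graph H

-- Next n i j says that j = i + 1 modulo n.
Next : (n : ℕ) → Rel (Fin n) 0ℓ
Next n i j = toℕ j ≡ suc (toℕ i) ⊎ (suc (toℕ i) ≡ n × toℕ j ≡ 0)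

Next-irrefl : ∀ {n} → 3 ≤ n → {i : Fin n} → ¬ Next n i i
Next-irrefl _   (inj₁ p) = 1+n≢n (sym p)
Next-irrefl 3≤n (inj₂ (p , q)) with trans (sym p) (cong suc q)
Next-irrefl (s≤s ()) (inj₂ (p , q)) | refl

cycle : (n : ℕ) → 3 ≤ n → Graph
cycle n 3≤n = record
  { V        = Fin n
  ; _≟_      = _≟ᶠ_
  ; vertices = allFin n
  ; unique   = allFin⁺ n
  ; complete = ∈-allFin
  ; Adj      = λ i j → Next n i j ⊎ Next n j i
  ; adj?     = λ i j → next? i j ⊎-dec next? j i
  ; adj-sym  = swap
  ; irrefl   = λ { (inj₁ p) → Next-irrefl 3≤n p ; (inj₂ p) → Next-irrefl 3≤n p }
  }
  where
  next? : Decidable (Next n)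
  next? i j = (toℕ j ≟ⁿ suc (toℕ i)) ⊎-dec ((suc (toℕ i) ≟ⁿ n) ×-dec (toℕ j ≟ⁿ 0))

{-# OPTIONS --safe #-}
-- Write A_y for the layers of a vertex set X of G ⊠ C_n. Counting ∂(X) layer by layer, every
-- pair of consecutive layers contributes to 4|∂(X)| a weight, and two proper (neither empty nor
-- full) layers weigh at least 12δ: uncrossing A and B compares the weight with the boundaries
-- of A ∩ B and A ∪ B, which have at least δ edges if the two sets are proper; otherwise A and B
-- are disjoint (up to complements), and counting the edges inside A ∪ B suffices. A proper
-- layer next to an improper one still contributes 6δ + 4. So four proper layers give 12δ, and
-- three, not filling the cycle, give 9δ + 2. With at most two, some layer may be taken empty,
-- and a layer with many vertices must be built up and torn down around the cycle, while if all
-- layers are small then X is small and degree counting applies. Hence |∂(X)| ≥ 9δ + 2 whenever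
-- X and its complement have at least four vertices. For |X| = 3, only triangles can do better,
-- and they attain 9δ exactly when G has an edge between two vertices of degree δ.
module Submission where

open import Defs
open import Data.Bool using (Bool; true; false; T; not; _∧_; _∨_; _xor_)
open import Data.Bool.Properties using (T?; T-∧; T-≡; T-irrelevant; xor-comm; not-involutive) renaming (_≟_ to _≟ᵇ_)
open import Data.Empty using (⊥-elim)
open import Data.Fin using (Fin; zero; suc; toℕ; fromℕ<; inject₁)
open import Data.Fin.Properties using (toℕ-injective; toℕ-fromℕ<; toℕ<n; toℕ-inject₁; any?) renaming (_≟_ to _≟ᶠ_)
open import Data.List using (List; []; _∷_; _++_; map; length; filter; allFin; tabulate; cartesianProduct)
open import Data.List.Properties using (map-++; map-∘; map-cong; map-tabulate; length-filter; length-tabulate)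
open import Data.List.Membership.Propositional using (_∈_; lose)
open import Data.List.Membership.Propositional.Properties using (∈-allFin)
open import Data.List.Relation.Unary.All using (All; []; _∷_)
import Data.List.Relation.Unary.All as All
import Data.List.Relation.Unary.All.Properties as AllP
open import Data.List.Relation.Unary.AllPairs using ([]; _∷_)
open import Data.List.Relation.Unary.Any using (here; there)
import Data.List.Relation.Unary.Any as Any
open import Data.List.Relation.Unary.Unique.Propositional using (Unique)
open import Data.List.Relation.Unary.Unique.Propositional.Properties using (filter⁺; allFin⁺)
open import Data.Nat using (ℕ; zero; suc; _+_; _*_; _∸_; _≤_; _<_; z≤n; s≤s; _≤?_; _<?_) renaming (_≟_ to _≟ⁿ_)
open import Data.Nat.DivMod using (_%_; _mod_; m<n⇒m%n≡m; n%n≡0; m%n<n)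
open import Data.Nat.ListAction using (sum)
open import Data.Nat.ListAction.Properties using (sum-++)
open import Data.Nat.Properties hiding (_≟_)
open import Data.Nat.Tactic.RingSolver using (solve-∀)
open import Data.Product using (Σ; ∃; ∃₂; _×_; _,_; proj₁; proj₂; uncurry)
open import Data.Sum using (_⊎_; inj₁; inj₂)
open import Data.Unit using (tt)
open import Function using (_∘_; flip; id)
open import Function.Bundles using (Equivalence)
open import Relation.Binary using (DecidableEquality)
open import Relation.Binary.Construct.Closure.ReflexiveTransitive using (Star; ε; _◅_; _◅◅_; reverse; gmap)
open import Relation.Binary.PropositionalEquality using (_≡_; _≢_; refl; sym; trans; cong; cong₂; subst; subst₂; module ≡-Reasoning)
open import Relation.Nullary using (¬_; Dec; yes; no; does; contradiction; _×-dec_)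
open import Relation.Nullary.Construct.Add.Supremum using ([_])
open import Relation.Nullary.Decidable using (dec-true; dec-false; decidable-stable; from-yes; map′; ¬¬-excluded-middle)

-- The target leaves little slack, and this fixes the constants. An edge inside a layer is shared by
-- two pairs of consecutive layers and is seen from both of its ends, so weights are scaled by four.
-- Three proper layers then give 36δ, and the missing 8 must come from the two places where the
-- cycle passes between proper and improper layers; these are the 4 in 6δ + 4. Two proper layers
-- give only 24δ + 8 out of the required 36δ + 8, so the argument changes there: from an empty layer
-- up to a layer with k vertices and back, at least 2k vertical and 2kδ diagonal edges of the
-- boundary are met. A 3-restricted edge-cut S enters only through a component X of G - S, as ∂(X)
-- is contained in S and both sides have at least three vertices. Conversely, degrees in the product
-- are at least 8, so a triple cannot isolate a small component by its boundary. Order at least 5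
-- separates full layers from small ones and settles A ∪ B = V; n at least 4 provides an improper
-- layer beside three proper ones and makes the cycle triangle-free.

variable
  A B : Set

-- Finite sums and indicators

⟦_⟧ : Bool → ℕ
⟦ true ⟧  = 1
⟦ false ⟧ = 0

∑ : List A → (A → ℕ) → ℕ
∑ xs f = sum (map f xs)

-- The form in which a Farkas certificate proves l ≤ r ⊢ a ≤ b: the slack s and
-- a semiring identity.
linear : ∀ {l r a b} s → l ≤ r → a + r + s ≡ b + l → a ≤ b
linear {l} {r} {a} {b} s l≤r eq = +-cancelʳ-≤ l a b (begin
  a + l      ≤⟨ +-monoʳ-≤ a l≤r ⟩
  a + r      ≤⟨ m≤m+n (a + r) s ⟩
  a + r + s  ≡⟨ eq ⟩
  b + l      ∎)
  where open ≤-Reasoning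

-- Makes truth tables computable: the pointwise estimates below are proved by evaluation through
-- `from-yes`.
∀Bool? : {P : Bool → Set} → (∀ b → Dec (P b)) → Dec (∀ b → P b)
∀Bool? P? with P? true | P? false
... | yes t | yes f = yes λ { true → t ; false → f }
... | no ¬t | _     = no λ h → ¬t (h true)
... | _     | no ¬f = no λ h → ¬f (h false)

does-cong : {P Q : Set} (p? : Dec P) (q? : Dec Q) → (P → Q) → (Q → P) → does p? ≡ does q?
does-cong (yes p) q? f g = sym (dec-true q? (f p))
does-cong (no ¬p) q? f g = sym (dec-false q? (¬p ∘ g))

∑-cong : ∀ (xs : List A) {f g : A → ℕ} → (∀ x → f x ≡ g x) → ∑ xs f ≡ ∑ xs g
∑-cong xs eq = cong sum (map-cong eq xs)

∑-mono : ∀ (xs : List A) {f g : A → ℕ} → (∀ x → f x ≤ g x) → ∑ xs f ≤ ∑ xs g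
∑-mono []       le = z≤n
∑-mono (x ∷ xs) le = +-mono-≤ (le x) (∑-mono xs le)

∑-distrib-+ : ∀ (xs : List A) (f g : A → ℕ) → ∑ xs (λ x → f x + g x) ≡ ∑ xs f + ∑ xs g
∑-distrib-+ []       f g = refl
∑-distrib-+ (x ∷ xs) f g rewrite ∑-distrib-+ xs f g =
  interchange (f x) (g x) (∑ xs f) (∑ xs g)
  where
  interchange : ∀ a b c d → a + b + (c + d) ≡ a + c + (b + d)
  interchange = solve-∀

∑-distribˡ-* : ∀ (xs : List A) k (f : A → ℕ) → ∑ xs (λ x → k * f x) ≡ k * ∑ xs f
∑-distribˡ-* []       k f = sym (*-zeroʳ k)
∑-distribˡ-* (x ∷ xs) k f =
  trans (cong (k * f x +_) (∑-distribˡ-* xs k f)) (sym (*-distribˡ-+ k (f x) (∑ xs f)))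

∑-distribʳ-* : ∀ (xs : List A) k (f : A → ℕ) → ∑ xs (λ x → f x * k) ≡ ∑ xs f * k
∑-distribʳ-* xs k f = trans (∑-cong xs λ x → *-comm (f x) k)
  (trans (∑-distribˡ-* xs k f) (*-comm k (∑ xs f)))

∑-const : ∀ (xs : List A) k → ∑ xs (λ _ → k) ≡ length xs * k
∑-const []       k = refl
∑-const (x ∷ xs) k = cong (k +_) (∑-const xs k)

∑-zero : ∀ (xs : List A) → ∑ xs (λ _ → 0) ≡ 0
∑-zero xs = trans (∑-const xs 0) (*-zeroʳ (length xs))

∑-swap : ∀ (xs : List A) (ys : List B) (f : A → B → ℕ) →
         ∑ xs (λ x → ∑ ys (f x)) ≡ ∑ ys (λ y → ∑ xs (λ x → f x y))
∑-swap []       ys f = sym (∑-zero ys)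
∑-swap (x ∷ xs) ys f = trans (cong (∑ ys (f x) +_) (∑-swap xs ys f))
  (sym (∑-distrib-+ ys (f x) (λ y → ∑ xs (λ x → f x y))))

∑-++ : ∀ (xs ys : List A) (f : A → ℕ) → ∑ (xs ++ ys) f ≡ ∑ xs f + ∑ ys f
∑-++ xs ys f = trans (cong sum (map-++ f xs ys)) (sum-++ (map f xs) (map f ys))

∑-map : ∀ (xs : List A) (g : A → B) (f : B → ℕ) → ∑ (map g xs) f ≡ ∑ xs (f ∘ g)
∑-map xs g f = cong sum (sym (map-∘ xs))

∑-cartesianProduct : ∀ (xs : List A) (ys : List B) (f : A × B → ℕ) →
  ∑ (cartesianProduct xs ys) f ≡ ∑ xs (λ x → ∑ ys (λ y → f (x , y)))
∑-cartesianProduct []       ys f = refl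
∑-cartesianProduct (x ∷ xs) ys f = trans (∑-++ (map (x ,_) ys) (cartesianProduct xs ys) f)
  (cong₂ _+_ (∑-map ys (x ,_) f) (∑-cartesianProduct xs ys f))

length-filter-∑ : {P : A → Set} (P? : ∀ x → Dec (P x)) (xs : List A) →
  length (filter P? xs) ≡ ∑ xs (λ x → ⟦ does (P? x) ⟧)
length-filter-∑ P? []       = refl
length-filter-∑ P? (x ∷ xs) with does (P? x)
... | true  = cong suc (length-filter-∑ P? xs)
... | false = length-filter-∑ P? xs

∑-filter : {P : A → Set} (P? : ∀ x → Dec (P x)) (xs : List A) (f : A → ℕ) →
  ∑ (filter P? xs) f ≡ ∑ xs (λ x → ⟦ does (P? x) ⟧ * f x)
∑-filter P? []       f = refl
∑-filter P? (x ∷ xs) f with does (P? x)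
... | true  = cong₂ _+_ (sym (*-identityˡ (f x))) (∑-filter P? xs f)
... | false = ∑-filter P? xs f

∑-∈ : ∀ {x : A} {xs} (f : A → ℕ) → x ∈ xs → f x ≤ ∑ xs f
∑-∈ {xs = x ∷ xs} f (here refl) = m≤m+n (f x) (∑ xs f)
∑-∈ {xs = y ∷ xs} f (there x∈)  = ≤-trans (∑-∈ f x∈) (m≤n+m (∑ xs f) (f y))

∑-vanish : ∀ (xs : List A) {f : A → ℕ} → All (λ x → f x ≡ 0) xs → ∑ xs f ≡ 0
∑-vanish []       []        = refl
∑-vanish (x ∷ xs) (p ∷ ps) = cong₂ _+_ p (∑-vanish xs ps)

∑-single : ∀ {x : A} {xs} {f : A → ℕ} → Unique xs → x ∈ xs →
  (∀ {y} → y ≢ x → f y ≡ 0) → ∑ xs f ≡ f x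
∑-single {xs = x ∷ xs} {f} (x∉ ∷ _) (here refl) off =
  trans (cong (f x +_) (∑-vanish xs (All.map (λ x≢y → off (x≢y ∘ sym)) x∉))) (+-identityʳ (f x))
∑-single {xs = y ∷ xs} {f} (y∉ ∷ u) (there x∈) off =
  cong₂ _+_ (off λ { refl → AllP.All¬⇒¬Any y∉ x∈ }) (∑-single u x∈ off)

∑-positive : ∀ (xs : List A) (f : A → ℕ) → 1 ≤ ∑ xs f → ∃ λ x → 1 ≤ f x
∑-positive (x ∷ xs) f le with f x in eq
... | suc _ = x , subst (1 ≤_) (sym eq) (s≤s z≤n)
... | zero  = ∑-positive xs f le

-- Every unordered pair of distinct entries is counted in both orders on the left.
∑-pairs : ∀ (xs : List A) (r : A → A → Bool) → (∀ x → r x x ≡ false) → (∀ x y → r x y ≡ r y x) →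
  ∑ xs (λ x → ∑ xs (λ y → ⟦ r x y ⟧)) ≡ 2 * ∑ (pairs xs) (λ p → ⟦ uncurry r p ⟧)
∑-pairs []       r irr symm = refl
∑-pairs (x ∷ xs) r irr symm = begin
  ⟦ r x x ⟧ + row + ∑ xs (λ y → ⟦ r y x ⟧ + ∑ xs (λ z → ⟦ r y z ⟧))
    ≡⟨ cong₂ (λ a b → a + row + b) (cong ⟦_⟧ (irr x))
         (∑-distrib-+ xs (λ y → ⟦ r y x ⟧) (λ y → ∑ xs (λ z → ⟦ r y z ⟧))) ⟩
  row + (∑ xs (λ y → ⟦ r y x ⟧) + ∑ xs (λ y → ∑ xs (λ z → ⟦ r y z ⟧)))
    ≡⟨ cong₂ (λ a b → row + (a + b)) (∑-cong xs λ y → cong ⟦_⟧ (symm y x)) (∑-pairs xs r irr symm) ⟩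
  row + (row + 2 * rest)
    ≡⟨ double row rest ⟩
  2 * (row + rest)
    ≡⟨ cong (λ a → 2 * (a + rest)) (sym (∑-map xs (x ,_) _)) ⟩
  2 * (∑ (map (x ,_) xs) (λ p → ⟦ uncurry r p ⟧) + rest)
    ≡⟨ cong (2 *_) (sym (∑-++ (map (x ,_) xs) (pairs xs) _)) ⟩
  2 * ∑ (pairs (x ∷ xs)) (λ p → ⟦ uncurry r p ⟧) ∎
  where
  open ≡-Reasoning
  row rest : ℕ
  row  = ∑ xs (λ y → ⟦ r x y ⟧)
  rest = ∑ (pairs xs) (λ p → ⟦ uncurry r p ⟧)
  double : ∀ a b → a + (a + 2 * b) ≡ 2 * (a + b)
  double = solve-∀

module _ (_≟_ : DecidableEquality A) where

  ∑-≟ : ∀ {xs} (x : A) (f : A → ℕ) → Unique xs → x ∈ xs →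
    ∑ xs (λ y → ⟦ does (x ≟ y) ⟧ * f y) ≡ f x
  ∑-≟ {xs} x f u x∈ = trans
    (∑-single u x∈ λ {y} y≢x → cong (λ b → ⟦ b ⟧ * f y) (dec-false (x ≟ y) (y≢x ∘ sym)))
    (trans (cong (λ b → ⟦ b ⟧ * f x) (dec-true (x ≟ x) refl)) (*-identityˡ (f x)))

  ∑-count≤1 : ∀ {xs} (y : A) → Unique xs → ∑ xs (λ x → ⟦ does (x ≟ y) ⟧) ≤ 1
  ∑-count≤1 {[]}     y []       = z≤n
  ∑-count≤1 {x ∷ xs} y (x∉ ∷ u) with x ≟ y
  ... | yes refl = s≤s (≤-reflexive
    (∑-vanish xs (All.map (λ {z} x≢z → cong ⟦_⟧ (dec-false (z ≟ x) (x≢z ∘ sym))) x∉)))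
  ... | no _     = ∑-count≤1 y u

  -- Double counting of the equal pairs in `xs` × `ys`: an entry of `xs` has one partner in `ys`,
  -- and an entry of `ys` has at most one in `xs`. It converts the list witnesses of `AtLeast` into
  -- cardinalities.
  unique-length≤ : ∀ {xs ys} (X : A → Bool) → Unique xs → (∀ x → x ∈ ys) → Unique ys →
    All (T ∘ X) xs → length xs ≤ ∑ ys (λ y → ⟦ X y ⟧)
  unique-length≤ {xs} {ys} X u complete u′ all = begin
    length xs                                             ≡⟨ ones xs all ⟨
    ∑ xs (λ x → ⟦ X x ⟧)                                   ≡⟨ ∑-cong xs (λ x → ∑-≟ x (⟦_⟧ ∘ X) u′ (complete x)) ⟨
    ∑ xs (λ x → ∑ ys (λ y → ⟦ does (x ≟ y) ⟧ * ⟦ X y ⟧))   ≡⟨ ∑-swap xs ys _ ⟩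
    ∑ ys (λ y → ∑ xs (λ x → ⟦ does (x ≟ y) ⟧ * ⟦ X y ⟧))   ≡⟨ ∑-cong ys (λ y → ∑-distribʳ-* xs ⟦ X y ⟧ _) ⟩
    ∑ ys (λ y → ∑ xs (λ x → ⟦ does (x ≟ y) ⟧) * ⟦ X y ⟧)   ≤⟨ ∑-mono ys (λ y → *-monoˡ-≤ ⟦ X y ⟧ (∑-count≤1 y u)) ⟩
    ∑ ys (λ y → 1 * ⟦ X y ⟧)                               ≡⟨ ∑-cong ys (λ y → *-identityˡ ⟦ X y ⟧) ⟩
    ∑ ys (λ y → ⟦ X y ⟧)                                   ∎
    where
    open ≤-Reasoning
    ones : ∀ zs → All (T ∘ X) zs → ∑ zs (λ x → ⟦ X x ⟧) ≡ length zs
    ones []       []       = refl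
    ones (z ∷ zs) (p ∷ ps) = cong₂ _+_ (cong ⟦_⟧ (Equivalence.to T-≡ p)) (ones zs ps)

⟦⟧-∧ : ∀ a b → ⟦ a ⟧ * ⟦ b ⟧ ≡ ⟦ a ∧ b ⟧
⟦⟧-∧ true  b = *-identityˡ ⟦ b ⟧
⟦⟧-∧ false b = refl

T-xor⁻ : ∀ {a b} → T (a xor b) → a ≢ b
T-xor⁻ {true}  {true}  ()
T-xor⁻ {true}  {false} _ ()
T-xor⁻ {false} {true}  _ ()

not-xor : ∀ a b → not a xor not b ≡ a xor b
not-xor = from-yes (∀Bool? λ a → ∀Bool? λ b → (not a xor not b) ≟ᵇ (a xor b))

complement : (A → Bool) → A → Bool
complement X = not ∘ X

-- Edge counts as sums over ordered adjacent pairs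

module Counting (G : Graph) where
  open Graph G

  ∑V : (V → ℕ) → ℕ
  ∑V = ∑ vertices

  α : V → V → ℕ
  α x y = ⟦ does (adj? x y) ⟧

  α-sym : ∀ x y → α x y ≡ α y x
  α-sym x y = cong ⟦_⟧ (does-cong (adj? x y) (adj? y x) adj-sym adj-sym)

  α-diag : ∀ x → α x x ≡ 0
  α-diag x = cong ⟦_⟧ (dec-false (adj? x x) irrefl)

  ∣_∣ : VertexSet G → ℕ
  ∣ X ∣ = ∑V (⟦_⟧ ∘ X)

  card-∑ : ∀ X → card G X ≡ ∣ X ∣
  card-∑ X = length-filter-∑ (T? ∘ X) vertices

  degree-∑ : ∀ x → degree x ≡ ∑V (α x)
  degree-∑ x = length-filter-∑ (adj? x) vertices

  -- All edge counts take this form, so an inequality between them needs checking only at a single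
  -- ordered pair, where it concerns a few Booleans.
  Q : (V → V → ℕ) → ℕ
  Q f = ∑V λ x → ∑V λ y → α x y * f x y

  Q-mono : ∀ {f g} → (∀ x y → f x y ≤ g x y) → Q f ≤ Q g
  Q-mono le = ∑-mono vertices λ x → ∑-mono vertices λ y → *-monoʳ-≤ (α x y) (le x y)

  Q-cong : ∀ {f g} → (∀ x y → f x y ≡ g x y) → Q f ≡ Q g
  Q-cong eq = ∑-cong vertices λ x → ∑-cong vertices λ y → cong (α x y *_) (eq x y)

  Q-+ : ∀ f g → Q (λ x y → f x y + g x y) ≡ Q f + Q g
  Q-+ f g = trans
    (∑-cong vertices λ x → trans
      (∑-cong vertices λ y → *-distribˡ-+ (α x y) (f x y) (g x y))
      (∑-distrib-+ vertices (λ y → α x y * f x y) (λ y → α x y * g x y)))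
    (∑-distrib-+ vertices _ _)

  Q-* : ∀ k f → Q (λ x y → k * f x y) ≡ k * Q f
  Q-* k f = trans
    (∑-cong vertices λ x → trans
      (∑-cong vertices λ y → exchange (α x y) k (f x y))
      (∑-distribˡ-* vertices k (λ y → α x y * f x y)))
    (∑-distribˡ-* vertices k _)
    where
    exchange : ∀ a k b → a * (k * b) ≡ k * (a * b)
    exchange = solve-∀

  Q-flip : ∀ f → Q (flip f) ≡ Q f
  Q-flip f = trans (∑-swap vertices vertices _)
    (∑-cong vertices λ x → ∑-cong vertices λ y → cong (_* f x y) (α-sym y x))

  Q-left : ∀ (f : V → ℕ) → Q (λ x _ → f x) ≡ ∑V (λ x → f x * degree x)
  Q-left f = ∑-cong vertices λ x → trans (∑-distribʳ-* vertices (f x) (α x))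
    (trans (cong (_* f x) (sym (degree-∑ x))) (*-comm (degree x) (f x)))

  -- D A A counts every edge of ∂(A) twice.
  D : VertexSet G → VertexSet G → ℕ
  D A B = Q λ x y → ⟦ A x xor B y ⟧

  diff : VertexSet G → VertexSet G → ℕ
  diff A B = ∑V λ x → ⟦ A x xor B x ⟧

  -- Twice the number of edges of G[A].
  e : VertexSet G → ℕ
  e A = Q λ x y → ⟦ A x ∧ A y ⟧

  μ : VertexSet G → ℕ
  μ A = ∑V λ x → ⟦ A x ⟧ * degree x

  D-sym : ∀ A B → D A B ≡ D B A
  D-sym A B = trans (Q-cong λ x y → cong ⟦_⟧ (xor-comm (A x) (B y))) (Q-flip λ x y → ⟦ B x xor A y ⟧)

  D-cong : ∀ {A B A′ B′} → (∀ x → A x ≡ A′ x) → (∀ x → B x ≡ B′ x) → D A B ≡ D A′ B′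
  D-cong p q = Q-cong λ x y → cong₂ (λ a b → ⟦ a xor b ⟧) (p x) (q y)

  D-complement : ∀ A B → D (complement A) (complement B) ≡ D A B
  D-complement A B = Q-cong λ x y → cong ⟦_⟧ (not-xor (A x) (B y))

  diff-complement : ∀ A B → diff (complement A) (complement B) ≡ diff A B
  diff-complement A B = ∑-cong vertices λ x → cong ⟦_⟧ (not-xor (A x) (B x))

  boundary-D : ∀ X → 2 * boundarySize G X ≡ D X X
  boundary-D X = trans (cong (2 *_) (length-filter-∑ _ (pairs vertices)))
    (trans (sym (∑-pairs vertices r r-irrefl r-sym))
           (∑-cong vertices λ x → ∑-cong vertices λ y → sym (⟦⟧-∧ (does (adj? x y)) (X x xor X y))))
    where
    r : V → V → Bool
    r x y = does (adj? x y) ∧ (X x xor X y)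
    r-irrefl : ∀ x → r x x ≡ false
    r-irrefl x = cong (_∧ (X x xor X x)) (dec-false (adj? x x) irrefl)
    r-sym : ∀ x y → r x y ≡ r y x
    r-sym x y = cong₂ _∧_ (does-cong (adj? x y) (adj? y x) adj-sym adj-sym) (xor-comm (X x) (X y))

  boundary-complement : ∀ X → boundarySize G (complement X) ≡ boundarySize G X
  boundary-complement X = *-cancelˡ-≡ _ _ 2
    (trans (boundary-D (complement X)) (trans (D-complement X X) (sym (boundary-D X))))

  -- The degree sum is read off once from the first and once from the second entry of an ordered
  -- pair; a pair inside A is then met twice and a pair leaving A once.
  handshake : ∀ A → 2 * μ A ≡ 2 * e A + D A A
  handshake A = begin
    2 * μ A                                             ≡⟨ cong (μ A +_) (+-identityʳ (μ A)) ⟩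
    μ A + μ A                                           ≡⟨ cong₂ _+_ (Q-left (⟦_⟧ ∘ A)) (trans (Q-flip _) (Q-left (⟦_⟧ ∘ A))) ⟨
    Q (λ x _ → ⟦ A x ⟧) + Q (λ _ y → ⟦ A y ⟧)           ≡⟨ Q-+ _ _ ⟨
    Q (λ x y → ⟦ A x ⟧ + ⟦ A y ⟧)                       ≡⟨ Q-cong (λ x y → split (A x) (A y)) ⟩
    Q (λ x y → 2 * ⟦ A x ∧ A y ⟧ + ⟦ A x xor A y ⟧)     ≡⟨ Q-+ _ _ ⟩
    Q (λ x y → 2 * ⟦ A x ∧ A y ⟧) + D A A               ≡⟨ cong (_+ D A A) (Q-* 2 _) ⟩
    2 * e A + D A A                                     ∎
    where
    open ≡-Reasoning
    split : ∀ a b → ⟦ a ⟧ + ⟦ b ⟧ ≡ 2 * ⟦ a ∧ b ⟧ + ⟦ a xor b ⟧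
    split = from-yes (∀Bool? λ a → ∀Bool? λ b → ⟦ a ⟧ + ⟦ b ⟧ ≟ⁿ 2 * ⟦ a ∧ b ⟧ + ⟦ a xor b ⟧)

  boundary+e : ∀ A → boundarySize G A + e A ≡ μ A
  boundary+e A = *-cancelˡ-≡ _ _ 2 (begin
    2 * (boundarySize G A + e A)       ≡⟨ *-distribˡ-+ 2 (boundarySize G A) (e A) ⟩
    2 * boundarySize G A + 2 * e A     ≡⟨ cong (_+ 2 * e A) (boundary-D A) ⟩
    D A A + 2 * e A                    ≡⟨ +-comm (D A A) (2 * e A) ⟩
    2 * e A + D A A                    ≡⟨ handshake A ⟨
    2 * μ A                            ∎)
    where open ≡-Reasoning

  -- Inside A × A the adjacent pairs and the diagonal are disjoint, as there are no loops.
  e+card≤card² : ∀ A → e A + ∣ A ∣ ≤ ∣ A ∣ * ∣ A ∣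
  e+card≤card² A = begin
    e A + ∣ A ∣
      ≡⟨ cong (e A +_) (∑-cong vertices λ x → sym (∑-≟ _≟_ x (λ _ → ⟦ A x ⟧) unique (complete x))) ⟩
    e A + ∑V (λ x → ∑V λ y → ⟦ does (x ≟ y) ⟧ * ⟦ A x ⟧)
      ≡⟨ ∑-distrib-+ vertices _ _ ⟨
    ∑V (λ x → ∑V (λ y → α x y * ⟦ A x ∧ A y ⟧) + ∑V (λ y → ⟦ does (x ≟ y) ⟧ * ⟦ A x ⟧))
      ≡⟨ ∑-cong vertices (λ x → sym (∑-distrib-+ vertices _ _)) ⟩
    ∑V (λ x → ∑V λ y → α x y * ⟦ A x ∧ A y ⟧ + ⟦ does (x ≟ y) ⟧ * ⟦ A x ⟧)
      ≤⟨ ∑-mono vertices (λ x → ∑-mono vertices (pointwise x)) ⟩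
    ∑V (λ x → ∑V λ y → ⟦ A x ⟧ * ⟦ A y ⟧)
      ≡⟨ ∑-cong vertices (λ x → ∑-distribˡ-* vertices ⟦ A x ⟧ _) ⟩
    ∑V (λ x → ⟦ A x ⟧ * ∣ A ∣)
      ≡⟨ ∑-distribʳ-* vertices ∣ A ∣ _ ⟩
    ∣ A ∣ * ∣ A ∣ ∎
    where
    open ≤-Reasoning
    diagonal : ∀ a → ⟦ a ⟧ + 0 ≤ ⟦ a ⟧ * ⟦ a ⟧
    diagonal = from-yes (∀Bool? λ a → ⟦ a ⟧ + 0 ≤? ⟦ a ⟧ * ⟦ a ⟧)
    offDiagonal : ∀ c a b → ⟦ c ⟧ * ⟦ a ∧ b ⟧ + 0 ≤ ⟦ a ⟧ * ⟦ b ⟧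
    offDiagonal = from-yes (∀Bool? λ c → ∀Bool? λ a → ∀Bool? λ b → ⟦ c ⟧ * ⟦ a ∧ b ⟧ + 0 ≤? ⟦ a ⟧ * ⟦ b ⟧)
    pointwise : ∀ x y → α x y * ⟦ A x ∧ A y ⟧ + ⟦ does (x ≟ y) ⟧ * ⟦ A x ⟧ ≤ ⟦ A x ⟧ * ⟦ A y ⟧
    pointwise x y with x ≟ y
    ... | yes refl rewrite α-diag x = diagonal (A x)
    ... | no _     = offDiagonal (does (adj? x y)) (A x) (A y)

  ⟦⟧-lipschitz : ∀ a b → ⟦ a ⟧ ≤ ⟦ b ⟧ + ⟦ a xor b ⟧
  ⟦⟧-lipschitz = from-yes (∀Bool? λ a → ∀Bool? λ b → ⟦ a ⟧ ≤? ⟦ b ⟧ + ⟦ a xor b ⟧)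

  -- For consecutive layers A and B, `μ A` counts the diagonal edges that leave A. Those ending in B
  -- number at most `μ B`, and the others are boundary edges.
  μ-lipschitz : ∀ A B → μ A ≤ μ B + D A B
  μ-lipschitz A B = begin
    μ A                              ≡⟨ Q-left (⟦_⟧ ∘ A) ⟨
    Q (λ x _ → ⟦ A x ⟧)              ≤⟨ Q-mono (λ x y → ⟦⟧-lipschitz (A x) (B y)) ⟩
    Q (λ x y → ⟦ B y ⟧ + ⟦ A x xor B y ⟧)  ≡⟨ Q-+ _ _ ⟩
    Q (λ _ y → ⟦ B y ⟧) + D A B      ≡⟨ cong (_+ D A B) (trans (Q-flip _) (Q-left (⟦_⟧ ∘ B))) ⟩
    μ B + D A B                      ∎
    where open ≤-Reasoning

  diff-sym : ∀ A B → diff A B ≡ diff B A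
  diff-sym A B = ∑-cong vertices λ x → cong ⟦_⟧ (xor-comm (A x) (B x))

  card-lipschitz : ∀ A B → ∣ A ∣ ≤ ∣ B ∣ + diff A B
  card-lipschitz A B = ≤-trans (∑-mono vertices λ x → ⟦⟧-lipschitz (A x) (B x))
    (≤-reflexive (∑-distrib-+ vertices _ _))

  μ-lower : ∀ {d} → (∀ x → d ≤ degree x) → ∀ A → ∣ A ∣ * d ≤ μ A
  μ-lower {d} d≤ A = begin
    ∣ A ∣ * d                ≡⟨ ∑-distribʳ-* vertices d _ ⟨
    ∑V (λ x → ⟦ A x ⟧ * d)   ≤⟨ ∑-mono vertices (λ x → *-monoʳ-≤ ⟦ A x ⟧ (d≤ x)) ⟩
    μ A                      ∎
    where open ≤-Reasoning

  card-pos : ∀ A {x} → A x ≡ true → 1 ≤ ∣ A ∣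
  card-pos A {x} Ax = subst (_≤ ∣ A ∣) (cong ⟦_⟧ Ax) (∑-∈ (⟦_⟧ ∘ A) (complete x))

  search : ∀ A → (∃ λ x → A x ≡ true) ⊎ (∀ x → A x ≡ false)
  search A with 1 ≤? ∣ A ∣
  ... | yes pos = inj₁ (let x , 1≤ = ∑-positive vertices _ pos in x , member (A x) 1≤)
    where
    member : ∀ a → 1 ≤ ⟦ a ⟧ → a ≡ true
    member true _ = refl
  ... | no ¬pos = inj₂ λ x → absent x (A x) refl
    where
    absent : ∀ x a → A x ≡ a → a ≡ false
    absent x true  Ax = contradiction (card-pos A Ax) ¬pos
    absent x false _  = refl

  card-empty : ∀ A → (∀ x → A x ≡ false) → ∣ A ∣ ≡ 0
  card-empty A empty = trans (∑-cong vertices (cong ⟦_⟧ ∘ empty)) (∑-zero vertices)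

  card-full : ∀ A → (∀ x → A x ≡ true) → ∣ A ∣ ≡ order
  card-full A full = trans (∑-cong vertices (cong ⟦_⟧ ∘ full))
    (trans (∑-const vertices 1) (*-identityʳ order))

  μ-empty : ∀ A → (∀ x → A x ≡ false) → μ A ≡ 0
  μ-empty A empty = trans (∑-cong vertices λ x → cong (λ a → ⟦ a ⟧ * degree x) (empty x)) (∑-zero vertices)

  boundaryEdges : VertexSet G → EdgeSet G
  boundaryEdges X = record
    { mem     = λ x y → does (adj? x y) ∧ (X x xor X y)
    ; mem-sym = λ {x} {y} → subst T (cong₂ _∧_ (does-cong (adj? x y) (adj? y x) adj-sym adj-sym) (xor-comm (X x) (X y)))
    ; mem-adj = λ {x} {y} t → adjacent (adj? x y) (proj₁ (Equivalence.to T-∧ t))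
    }
    where
    adjacent : ∀ {P : Set} (p? : Dec P) → T (does p?) → P
    adjacent (yes p) _ = p

  size-boundaryEdges : ∀ X → size G (boundaryEdges X) ≡ boundarySize G X
  size-boundaryEdges X = trans (length-filter-∑ _ (pairs vertices)) (sym (length-filter-∑ _ (pairs vertices)))

  boundaryEdges-mem : ∀ X {x y} → Adj x y → X x ≢ X y → T (EdgeSet.mem (boundaryEdges X) x y)
  boundaryEdges-mem X {x} {y} adj X≢ rewrite dec-true (adj? x y) adj = differ (X x) (X y) X≢
    where
    differ : ∀ a b → a ≢ b → T (a xor b)
    differ true  true  ≢ = ⊥-elim (≢ refl)
    differ true  false _ = tt
    differ false true  _ = tt
    differ false false ≢ = ⊥-elim (≢ refl)

  boundaryEdges-separate : ∀ X {x y} → Star (Without G (boundaryEdges X)) x y → X x ≡ X y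
  boundaryEdges-separate X ε = refl
  boundaryEdges-separate X {x} (_◅_ {j = z} (adj , ¬mem) rest) with X x ≟ᵇ X z
  ... | yes eq = trans eq (boundaryEdges-separate X rest)
  ... | no neq = ⊥-elim (¬mem (boundaryEdges-mem X adj neq))

  -- The boundary of a proper set is an edge-cut. The edge-connectivity of G enters the proof only
  -- in this form.
  connectivity≤boundary : ∀ {k} → IsEdgeConnectivity G k → ∀ A {x y} → A x ≡ true → A y ≡ false →
    k ≤ boundarySize G A
  connectivity≤boundary (_ , k≤) A {x} {y} Ax Ay = subst (_ ≤_) (size-boundaryEdges A)
    (k≤ (boundaryEdges A , λ conn → true≢false (trans (sym Ax) (trans (boundaryEdges-separate A (conn x y)) Ay))))
    where
    true≢false : ¬ true ≡ false
    true≢false ()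

-- Weights of two consecutive layers

disjoint-arithmetic : ∀ d c e D → 2 ≤ d → 2 ≤ c → e + c ≤ c * c → 2 * (c * d) ≤ 2 * e + D →
  2 * d ≤ D ⊎ (5 ≤ c × d ≤ c) → 12 * d ≤ 4 * c + (3 * D + 2 * e)
disjoint-arithmetic d 1 e D 2≤d (s≤s ()) h₁ h₂ h₃
-- For c ≤ 3 the bound e ≤ c (c - 1) is strong enough: subtract 4e from three times the degree
-- count. For c = 2 this gives exactly 12d, and the vertical term 4c is indispensable.
disjoint-arithmetic d 2 e D 2≤d 2≤c h₁ h₂ h₃ =
  linear 0 (+-mono-≤ (*-monoʳ-≤ 3 h₂) (*-monoʳ-≤ 4 h₁)) (eq d e D)
  where
  eq : ∀ d e D → 12 * d + (3 * (2 * e + D) + 4 * 4) + 0 ≡ 4 * 2 + (3 * D + 2 * e) + (3 * (2 * (2 * d)) + 4 * (e + 2))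
  eq = solve-∀
disjoint-arithmetic d 3 e D 2≤d 2≤c h₁ h₂ h₃ =
  linear 0 (+-mono-≤ (*-monoʳ-≤ 6 2≤d) (+-mono-≤ (*-monoʳ-≤ 3 h₂) (*-monoʳ-≤ 4 h₁))) (eq d e D)
  where
  eq : ∀ d e D → 12 * d + (6 * d + (3 * (2 * e + D) + 4 * 9)) + 0
                 ≡ 4 * 3 + (3 * D + 2 * e) + (6 * 2 + (3 * (2 * (3 * d)) + 4 * (e + 3)))
  eq = solve-∀
-- From c ≥ 4, the degree count yields 8d and two of the three copies of D yield the other 4d.
disjoint-arithmetic d c@(suc (suc (suc (suc k)))) e D 2≤d 2≤c h₁ h₂ (inj₁ h₃) =
  linear (4 * c + 2 * (k * d)) (+-mono-≤ (*-monoʳ-≤ 2 h₃) h₂) (eq d k e D)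
  where
  eq : ∀ d k e D → 12 * d + (2 * D + (2 * e + D)) + (4 * (4 + k) + 2 * (k * d))
                   ≡ 4 * (4 + k) + (3 * D + 2 * e) + (2 * (2 * d) + 2 * ((4 + k) * d))
  eq = solve-∀
disjoint-arithmetic d 4 e D 2≤d 2≤c h₁ h₂ (inj₂ (s≤s (s≤s (s≤s (s≤s ()))) , _))
-- The union is all of V, so no lower bound on D is available: the degree count gives 10d, and 4c =
-- 20 covers the remaining 2d.
disjoint-arithmetic d 5 e D 2≤d 2≤c h₁ h₂ (inj₂ (_ , d≤5)) =
  linear (2 * d + 2 * D) (+-mono-≤ h₂ (*-monoʳ-≤ 4 d≤5)) (eq d e D)
  where
  eq : ∀ d e D → 12 * d + (2 * e + D + 4 * 5) + (2 * d + 2 * D)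
                 ≡ 4 * 5 + (3 * D + 2 * e) + (2 * (5 * d) + 4 * d)
  eq = solve-∀
disjoint-arithmetic d c@(suc (suc (suc (suc (suc (suc i)))))) e D 2≤d 2≤c h₁ h₂ (inj₂ _) =
  linear (4 * c + 2 * D + 2 * (i * d)) h₂ (eq d i e D)
  where
  eq : ∀ d i e D → 12 * d + (2 * e + D) + (4 * (6 + i) + 2 * D + 2 * (i * d))
                   ≡ 4 * (6 + i) + (3 * D + 2 * e) + 2 * ((6 + i) * d)
  eq = solve-∀

distance : ℕ → ℕ → ℕ
distance m n = (m ∸ n) + (n ∸ m)

module LayerBounds (G : Graph) (d : ℕ)
  (d≤degree : ∀ x → d ≤ Graph.degree G x)
  (d≤boundary : ∀ A {x y} → A x ≡ true → A y ≡ false → d ≤ boundarySize G A)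
  (2≤d : 2 ≤ d) (d≤order : d ≤ Graph.order G) (5≤order : 5 ≤ Graph.order G) where
  open Graph G
  open Counting G

  2d≤D : ∀ A {x y} → A x ≡ true → A y ≡ false → 2 * d ≤ D A A
  2d≤D A Ax Ay = ≤-trans (*-monoʳ-≤ 2 (d≤boundary A Ax Ay)) (≤-reflexive (boundary-D A))

  -- 4 diff A B + 4 D A B + D A A + D B B is four times the number of boundary edges
  -- between two consecutive layers A and B, edges within a layer counting one half.
  weight : VertexSet G → VertexSet G → ℕ
  weight A B = 4 * diff A B + (4 * D A B + (D A A + D B B))

  weight-complement : ∀ A B → weight (complement A) (complement B) ≡ weight A B
  weight-complement A B = cong₂ _+_ (cong (4 *_) (diff-complement A B))
    (cong₂ _+_ (cong (4 *_) (D-complement A B)) (cong₂ _+_ (D-complement A A) (D-complement B B)))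

  weight-sym : ∀ A B → weight A B ≡ weight B A
  weight-sym A B = cong₂ _+_ (cong (4 *_) (diff-sym A B))
    (cong₂ _+_ (cong (4 *_) (D-sym A B)) (+-comm (D A A) (D B B)))

  infixr 7 _⊓_ _⊔_ _⊕_
  _⊓_ _⊔_ _⊕_ : VertexSet G → VertexSet G → VertexSet G
  (A ⊓ B) x = A x ∧ B x
  (A ⊔ B) x = A x ∨ B x
  (A ⊕ B) x = A x xor B x

  -- `D A B` is first symmetrised to half of `D A B + D B A`. Pointwise, the two sides then agree in
  -- all cases but one: for an adjacent pair with both ends in A only, or both in B only, the left
  -- side is smaller by 2.
  uncross : ∀ A B →
    3 * (D (A ⊓ B) (A ⊓ B) + D (A ⊔ B) (A ⊔ B)) + 2 * e (A ⊕ B) ≤ 4 * D A B + (D A A + D B B)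
  uncross A B = begin
    3 * (D (A ⊓ B) (A ⊓ B) + D (A ⊔ B) (A ⊔ B)) + 2 * e (A ⊕ B)
      ≡⟨ cong₂ _+_ (trans (Q-* 3 _) (cong (3 *_) (Q-+ _ _))) (Q-* 2 _) ⟨
    Q (λ x y → 3 * (⟦ (A ⊓ B) x xor (A ⊓ B) y ⟧ + ⟦ (A ⊔ B) x xor (A ⊔ B) y ⟧))
      + Q (λ x y → 2 * ⟦ (A ⊕ B) x ∧ (A ⊕ B) y ⟧)
      ≡⟨ Q-+ _ _ ⟨
    Q (λ x y → 3 * (⟦ (A ⊓ B) x xor (A ⊓ B) y ⟧ + ⟦ (A ⊔ B) x xor (A ⊔ B) y ⟧)
      + 2 * ⟦ (A ⊕ B) x ∧ (A ⊕ B) y ⟧)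
      ≤⟨ Q-mono (λ x y → pointwise (A x) (A y) (B x) (B y)) ⟩
    Q (λ x y → 2 * (⟦ A x xor B y ⟧ + ⟦ B x xor A y ⟧) + (⟦ A x xor A y ⟧ + ⟦ B x xor B y ⟧))
      ≡⟨ trans (Q-+ _ _) (cong₂ _+_ (trans (Q-* 2 _) (cong (2 *_) (Q-+ _ _))) (Q-+ _ _)) ⟩
    2 * (D A B + D B A) + (D A A + D B B)
      ≡⟨ cong (λ n → 2 * (D A B + n) + (D A A + D B B)) (D-sym B A) ⟩
    2 * (D A B + D A B) + (D A A + D B B)
      ≡⟨ cong (_+ (D A A + D B B)) (double (D A B)) ⟩
    4 * D A B + (D A A + D B B) ∎
    where
    open ≤-Reasoning
    double : ∀ n → 2 * (n + n) ≡ 4 * n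
    double = solve-∀
    pointwise : ∀ a a′ b b′ →
      3 * (⟦ (a ∧ b) xor (a′ ∧ b′) ⟧ + ⟦ (a ∨ b) xor (a′ ∨ b′) ⟧) + 2 * ⟦ (a xor b) ∧ (a′ xor b′) ⟧
      ≤ 2 * (⟦ a xor b′ ⟧ + ⟦ b xor a′ ⟧) + (⟦ a xor a′ ⟧ + ⟦ b xor b′ ⟧)
    pointwise = from-yes (∀Bool? λ a → ∀Bool? λ a′ → ∀Bool? λ b → ∀Bool? λ b′ →
      3 * (⟦ (a ∧ b) xor (a′ ∧ b′) ⟧ + ⟦ (a ∨ b) xor (a′ ∨ b′) ⟧) + 2 * ⟦ (a xor b) ∧ (a′ xor b′) ⟧
      ≤? 2 * (⟦ a xor b′ ⟧ + ⟦ b xor a′ ⟧) + (⟦ a xor a′ ⟧ + ⟦ b xor b′ ⟧))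

  -- Uncrossing says nothing about the empty intersection. The union M coincides with the symmetric
  -- difference, so the vertical edges number |M|, and the term `e M` makes the degree sum of M
  -- available.
  weight-disjoint : ∀ A B {x y} → A x ≡ true → B y ≡ true → (∀ z → (A ⊓ B) z ≡ false) → 12 * d ≤ weight A B
  weight-disjoint A B {x} Ax By disjoint = ≤-trans bound (+-monoʳ-≤ (4 * c) uncrossed)
    where
    M : VertexSet G
    M = A ⊕ B
    c : ℕ
    c = ∣ M ∣
    union-M : ∀ z → (A ⊔ B) z ≡ M z
    union-M z = or≡xor (A z) (B z) (disjoint z)
      where
      or≡xor : ∀ a b → a ∧ b ≡ false → a ∨ b ≡ a xor b
      or≡xor true  false _ = refl
      or≡xor false b     _ = refl
    2≤c : 2 ≤ c
    2≤c = ≤-trans (+-mono-≤ (card-pos A Ax) (card-pos B By)) (≤-trans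
      (≤-reflexive (sym (∑-distrib-+ vertices _ _)))
      (∑-mono vertices λ z → sum≤xor (A z) (B z) (disjoint z)))
      where
      sum≤xor : ∀ a b → a ∧ b ≡ false → ⟦ a ⟧ + ⟦ b ⟧ ≤ ⟦ a xor b ⟧
      sum≤xor true  false _ = ≤-refl
      sum≤xor false b     _ = ≤-refl
    uncrossed : 3 * D M M + 2 * e M ≤ 4 * D A B + (D A A + D B B)
    uncrossed = ≤-trans (+-monoˡ-≤ (2 * e M) (*-monoʳ-≤ 3
        (≤-trans (≤-reflexive (sym (D-cong union-M union-M))) (m≤n+m (D (A ⊔ B) (A ⊔ B)) (D (A ⊓ B) (A ⊓ B))))))
      (uncross A B)
    2cd≤ : 2 * (c * d) ≤ 2 * e M + D M M
    2cd≤ = ≤-trans (*-monoʳ-≤ 2 (μ-lower d≤degree M)) (≤-reflexive (handshake M))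
    -- Either M misses a vertex and edge-connectivity applies, or M = V and c is the order of G.
    condition : 2 * d ≤ D M M ⊎ (5 ≤ c × d ≤ c)
    condition with search (complement M)
    ... | inj₁ (z , ¬Mz) = inj₁ (2d≤D M Mx (trans (sym (not-involutive (M z))) (cong not ¬Mz)))
      where
      Mx : M x ≡ true
      Mx = trans (sym (union-M x)) (cong (_∨ B x) Ax)
    ... | inj₂ full = inj₂ (subst (5 ≤_) (sym c≡order) 5≤order , subst (d ≤_) (sym c≡order) d≤order)
      where
      c≡order : c ≡ order
      c≡order = card-full M λ z → trans (sym (not-involutive (M z))) (cong not (full z))
    bound : 12 * d ≤ 4 * c + (3 * D M M + 2 * e M)
    bound = disjoint-arithmetic d c (e M) (D M M) 2≤d 2≤c (e+card≤card² M) 2cd≤ condition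

  weight-proper : ∀ A B {x x′ y y′} → A x ≡ true → A x′ ≡ false → B y ≡ true → B y′ ≡ false →
    12 * d ≤ weight A B
  weight-proper A B Ax Ax′ By By′ with search (A ⊓ B) | search (complement (A ⊔ B))
  ... | inj₂ disjoint | _ = weight-disjoint A B Ax By disjoint
  ... | inj₁ _ | inj₂ cover = subst (12 * d ≤_) (weight-complement A B)
      (weight-disjoint (complement A) (complement B) (cong not Ax′) (cong not By′)
        λ z → trans (deMorgan (A z) (B z)) (cover z))
    where
    deMorgan : ∀ a b → not a ∧ not b ≡ not (a ∨ b)
    deMorgan true  b = refl
    deMorgan false b = refl
  ... | inj₁ (z , ABz) | inj₁ (w , ¬ABw) = ≤-trans
      (linear (2 * e (A ⊕ B)) (*-monoʳ-≤ 3 (+-mono-≤ (2d≤D (A ⊓ B) ABz (both-false (A w) (B w) ¬ABw))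
                                        (2d≤D (A ⊔ B) (either-true (A z) (B z) ABz) (neither (A w) (B w) ¬ABw))))
        (eq d (D (A ⊓ B) (A ⊓ B)) (D (A ⊔ B) (A ⊔ B)) (e (A ⊕ B))))
      (≤-trans (uncross A B) (m≤n+m _ (4 * diff A B)))
    where
    both-false : ∀ a b → not (a ∨ b) ≡ true → a ∧ b ≡ false
    both-false false b _ = refl
    neither : ∀ a b → not (a ∨ b) ≡ true → a ∨ b ≡ false
    neither false false _ = refl
    either-true : ∀ a b → a ∧ b ≡ true → a ∨ b ≡ true
    either-true true b _ = refl
    eq : ∀ d p q e → 12 * d + 3 * (p + q) + 2 * e ≡ 3 * (p + q) + 2 * e + 3 * (2 * d + 2 * d)
    eq = solve-∀

  -- A vertex of A has one vertical and at least d diagonal edges into B, worth 4 + 4d; the boundary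
  -- of A within its own layer adds 2d.
  weight-empty : ∀ A B {x x′} → A x ≡ true → A x′ ≡ false → (∀ y → B y ≡ false) → 6 * d + 4 ≤ weight A B
  weight-empty A B {x} Ax Ax′ empty =
    linear (D B B) (+-mono-≤ (*-monoʳ-≤ 4 1≤diff) (+-mono-≤ (*-monoʳ-≤ 4 d≤D) (2d≤D A Ax Ax′)))
      (eq d (diff A B) (D A B) (D A A) (D B B))
    where
    1≤diff : 1 ≤ diff A B
    1≤diff = ≤-trans (card-pos A Ax)
      (subst (λ n → ∣ A ∣ ≤ n + diff A B) (card-empty B empty) (card-lipschitz A B))
    d≤D : d ≤ D A B
    d≤D = begin
      d              ≡⟨ *-identityˡ d ⟨
      1 * d          ≤⟨ *-monoˡ-≤ d (card-pos A Ax) ⟩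
      ∣ A ∣ * d      ≤⟨ μ-lower d≤degree A ⟩
      μ A            ≤⟨ μ-lipschitz A B ⟩
      μ B + D A B    ≡⟨ cong (_+ D A B) (μ-empty B empty) ⟩
      D A B          ∎
      where open ≤-Reasoning
    eq : ∀ d v D DA DB → 6 * d + 4 + (4 * v + (4 * D + DA)) + DB
                         ≡ 4 * v + (4 * D + (DA + DB)) + (4 * 1 + (4 * d + 2 * d))
    eq = solve-∀

  weight-full : ∀ A B {x x′} → A x ≡ true → A x′ ≡ false → (∀ y → B y ≡ true) → 6 * d + 4 ≤ weight A B
  weight-full A B Ax Ax′ full = subst (6 * d + 4 ≤_) (weight-complement A B)
    (weight-empty (complement A) (complement B) (cong not Ax′) (cong not Ax) (cong not ∘ full))

  data Kind (A : VertexSet G) : Set where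
    proper : ∀ {x y} → A x ≡ true → A y ≡ false → Kind A
    empty  : (∀ x → A x ≡ false) → Kind A
    full   : (∀ x → A x ≡ true) → Kind A

  kind : ∀ A → Kind A
  kind A with search A | search (complement A)
  ... | inj₂ none | _ = empty none
  ... | inj₁ _ | inj₂ all = full λ x → trans (sym (not-involutive (A x))) (cong not (all x))
  ... | inj₁ (x , Ax) | inj₁ (y , ¬Ay) = proper Ax (trans (sym (not-involutive (A y))) (cong not ¬Ay))

  properness : ∀ {A} → Kind A → ℕ
  properness (proper _ _) = 1
  properness (empty _)    = 0
  properness (full _)     = 0

  -- One formula for the three values 12d, 6d + 4 and 0. Summed round the cycle, it separates into
  -- the number of proper layers and the number of changes between proper and improper ones.
  weight-bound : ∀ {A B} (a : Kind A) (b : Kind B) →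
    6 * d * (properness a + properness b) + 4 * distance (properness a) (properness b) ≤ weight A B
  weight-bound {A} {B} (proper p q) (proper r s) = ≤-trans (≤-reflexive (eq d)) (weight-proper A B p q r s)
    where
    eq : ∀ d → 6 * d * 2 + 0 ≡ 12 * d
    eq = solve-∀
  weight-bound {A} {B} (proper p q) (empty f) = ≤-trans (≤-reflexive (cong (_+ 4) (*-identityʳ (6 * d)))) (weight-empty A B p q f)
  weight-bound {A} {B} (proper p q) (full f)  = ≤-trans (≤-reflexive (cong (_+ 4) (*-identityʳ (6 * d)))) (weight-full A B p q f)
  weight-bound {A} {B} (empty f) (proper p q) = ≤-trans (≤-reflexive (cong (_+ 4) (*-identityʳ (6 * d))))
    (≤-trans (weight-empty B A p q f) (≤-reflexive (weight-sym B A)))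
  weight-bound {A} {B} (full f)  (proper p q) = ≤-trans (≤-reflexive (cong (_+ 4) (*-identityʳ (6 * d))))
    (≤-trans (weight-full B A p q f) (≤-reflexive (weight-sym B A)))
  weight-bound (empty _) (empty _) = ≤-trans (≤-reflexive (cong (_+ 0) (*-zeroʳ (6 * d)))) z≤n
  weight-bound (empty _) (full _)  = ≤-trans (≤-reflexive (cong (_+ 0) (*-zeroʳ (6 * d)))) z≤n
  weight-bound (full _)  (empty _) = ≤-trans (≤-reflexive (cong (_+ 0) (*-zeroʳ (6 * d)))) z≤n
  weight-bound (full _)  (full _)  = ≤-trans (≤-reflexive (cong (_+ 0) (*-zeroʳ (6 * d)))) z≤n

-- Sums and total variation on the cycle

partialSum : (ℕ → ℕ) → ℕ → ℕ
partialSum φ zero    = 0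
partialSum φ (suc i) = partialSum φ i + φ i

-- Needed because `partialSum` splits off its last term and `tabulate` its first.
partialSum-shift : ∀ φ i → φ 0 + partialSum (φ ∘ suc) i ≡ partialSum φ (suc i)
partialSum-shift φ zero    = +-identityʳ (φ 0)
partialSum-shift φ (suc i) = trans (sym (+-assoc (φ 0) _ _)) (cong (_+ φ (suc i)) (partialSum-shift φ i))

∑-allFin : ∀ φ n → ∑ (allFin n) (φ ∘ toℕ) ≡ partialSum φ n
∑-allFin φ n = trans (cong sum (map-tabulate {n = n} id (φ ∘ toℕ))) (go φ n)
  where
  go : ∀ φ n → sum (tabulate {n = n} (φ ∘ toℕ)) ≡ partialSum φ n
  go φ zero    = refl
  go φ (suc n) = trans (cong (φ 0 +_) (go (φ ∘ suc) n)) (partialSum-shift φ n)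

module Cyclic (m : ℕ) (3≤n : 3 ≤ suc m) where

  n : ℕ
  n = suc m

  next prev : Fin n → Fin n
  next y = suc (toℕ y) mod n
  prev zero    = fromℕ< (n<1+n m)
  prev (suc y) = inject₁ y

  toℕ-mod : ∀ i → toℕ (i mod n) ≡ i % n
  toℕ-mod i = toℕ-fromℕ< (m%n<n i n)

  mod-toℕ : ∀ y → toℕ y mod n ≡ y
  mod-toℕ y = toℕ-injective (trans (toℕ-mod (toℕ y)) (m<n⇒m%n≡m (toℕ<n y)))

  Next-unique : ∀ {x y} → Next n x y → y ≡ next x
  Next-unique {x} {y} (inj₁ y≡) =
    toℕ-injective (sym (trans (toℕ-mod (suc (toℕ x))) (trans (cong (_% n) (sym y≡)) (m<n⇒m%n≡m (toℕ<n y)))))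
  Next-unique {x} {y} (inj₂ (x≡ , y≡)) =
    toℕ-injective (sym (trans (toℕ-mod (suc (toℕ x))) (trans (cong (_% n) x≡) (trans (n%n≡0 n) (sym y≡)))))

  Next-prev : ∀ y → Next n (prev y) y
  Next-prev zero    = inj₂ (cong suc (toℕ-fromℕ< (n<1+n m)) , refl)
  Next-prev (suc y) = inj₁ (cong suc (sym (toℕ-inject₁ y)))

  Next-next : ∀ y → Next n y (next y)
  Next-next y with m≤n⇒m<n∨m≡n (toℕ<n y)
  ... | inj₁ lt = inj₁ (trans (toℕ-mod (suc (toℕ y))) (m<n⇒m%n≡m lt))
  ... | inj₂ eq = inj₂ (eq , trans (toℕ-mod (suc (toℕ y))) (trans (cong (_% n) eq) (n%n≡0 n)))

  next-prev : ∀ y → next (prev y) ≡ y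
  next-prev y = sym (Next-unique (Next-prev y))

  Next-injective : ∀ {x x′ y} → Next n x y → Next n x′ y → x ≡ x′
  Next-injective (inj₁ p) (inj₁ q) = toℕ-injective (suc-injective (trans (sym p) q))
  Next-injective (inj₁ p) (inj₂ (_ , q)) = ⊥-elim (0≢1+n (trans (sym q) p))
  Next-injective (inj₂ (_ , p)) (inj₁ q) = ⊥-elim (0≢1+n (trans (sym p) q))
  Next-injective (inj₂ (p , _)) (inj₂ (q , _)) = toℕ-injective (suc-injective (trans p (sym q)))

  prev-next : ∀ y → prev (next y) ≡ y
  prev-next y = Next-injective (Next-prev (next y)) (Next-next y)

  -- With n ≥ 3 the successor and the predecessor of a vertex differ, so the two indicators in
  -- `β-split` do not overlap.
  Next-asym : ∀ {x y} → Next n x y → ¬ Next n y x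
  Next-asym (inj₁ p) (inj₁ q) = <-irrefl (trans q (cong suc p)) (m<n⇒m<1+n (n<1+n _))
  Next-asym (inj₁ p) (inj₂ (q , r)) = <-irrefl (trans (sym (cong suc (trans p (cong suc r)))) q) 3≤n
  Next-asym (inj₂ (p , q)) (inj₁ r) = <-irrefl (trans (sym (cong suc (trans r (cong suc q)))) p) 3≤n
  Next-asym (inj₂ (p , q)) (inj₂ (r , s)) = <-irrefl (trans (sym (cong suc s)) p) (≤-trans (s≤s (s≤s z≤n)) 3≤n)

  C : Graph
  C = cycle n 3≤n

  open Counting C using () renaming (∑V to ∑F; α to β) public

  β-split : ∀ y z → β y z ≡ ⟦ does (next y ≟ᶠ z) ⟧ + ⟦ does (prev y ≟ᶠ z) ⟧
  β-split y z with next y ≟ᶠ z | prev y ≟ᶠ z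
  ... | yes refl | yes eq = ⊥-elim (Next-asym (subst (λ x → Next n x y) eq (Next-prev y)) (Next-next y))
  ... | yes refl | no _   = cong ⟦_⟧ (dec-true (Graph.adj? C y z) (inj₁ (Next-next y)))
  ... | no _ | yes refl   = cong ⟦_⟧ (dec-true (Graph.adj? C y z) (inj₂ (Next-prev y)))
  ... | no ≢s | no ≢p     = cong ⟦_⟧ (dec-false (Graph.adj? C y z) λ
    { (inj₁ q) → ≢s (sym (Next-unique q))
    ; (inj₂ q) → ≢p (Next-injective (Next-prev y) q) })

  ∑-β : ∀ y (g : Fin n → ℕ) → ∑F (λ z → β y z * g z) ≡ g (next y) + g (prev y)
  ∑-β y g = begin
    ∑F (λ z → β y z * g z)
      ≡⟨ ∑-cong (allFin n) (λ z → trans (cong (_* g z) (β-split y z)) (*-distribʳ-+ (g z) ⟦ does (next y ≟ᶠ z) ⟧ _)) ⟩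
    ∑F (λ z → ⟦ does (next y ≟ᶠ z) ⟧ * g z + ⟦ does (prev y ≟ᶠ z) ⟧ * g z)
      ≡⟨ ∑-distrib-+ (allFin n) (λ z → ⟦ does (next y ≟ᶠ z) ⟧ * g z) (λ z → ⟦ does (prev y ≟ᶠ z) ⟧ * g z) ⟩
    ∑F (λ z → ⟦ does (next y ≟ᶠ z) ⟧ * g z) + ∑F (λ z → ⟦ does (prev y ≟ᶠ z) ⟧ * g z)
      ≡⟨ cong₂ _+_ (∑-≟ _≟ᶠ_ (next y) g (allFin⁺ n) (∈-allFin _)) (∑-≟ _≟ᶠ_ (prev y) g (allFin⁺ n) (∈-allFin _)) ⟩
    g (next y) + g (prev y) ∎
    where open ≡-Reasoning

  ∑-prev : ∀ (f : Fin n → ℕ) → ∑F (f ∘ prev) ≡ ∑F f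
  ∑-prev f = begin
    ∑F (λ y → f (prev y))
      ≡⟨ ∑-cong (allFin n) (λ y → ∑-≟ _≟ᶠ_ (prev y) f (allFin⁺ n) (∈-allFin _)) ⟨
    ∑F (λ y → ∑F λ z → ⟦ does (prev y ≟ᶠ z) ⟧ * f z)
      ≡⟨ ∑-swap (allFin n) (allFin n) _ ⟩
    ∑F (λ z → ∑F λ y → ⟦ does (prev y ≟ᶠ z) ⟧ * f z)
      ≡⟨ ∑-cong (allFin n) (λ z → ∑-cong (allFin n) λ y → cong (λ b → ⟦ b ⟧ * f z)
           (does-cong (prev y ≟ᶠ z) (next z ≟ᶠ y)
             (λ { refl → next-prev y }) (λ { refl → prev-next z }))) ⟩
    ∑F (λ z → ∑F λ y → ⟦ does (next z ≟ᶠ y) ⟧ * f z)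
      ≡⟨ ∑-cong (allFin n) (λ z → ∑-≟ _≟ᶠ_ (next z) (λ _ → f z) (allFin⁺ n) (∈-allFin _)) ⟩
    ∑F f ∎
    where open ≡-Reasoning

  ∑-next : ∀ (f : Fin n → ℕ) → ∑F (f ∘ next) ≡ ∑F f
  ∑-next f = trans (sym (∑-prev (f ∘ next))) (∑-cong (allFin n) (cong f ∘ next-prev))

  -- A function on the cycle goes up from its value at b to its value at a along both
  -- arcs, so its total variation is at least twice the difference.
  variation : (t w : Fin n → ℕ) → (∀ y → t y ≤ t (next y) + w y) → (∀ y → t (next y) ≤ t y + w y) →
    ∀ a b → 2 * t a ≤ 2 * t b + ∑F w
  variation t w down up a b = subst₂ (λ x y → 2 * t x ≤ 2 * t y + ∑F w) (mod-toℕ a) (mod-toℕ b)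
    (≤-trans (both (≤-total (toℕ a) (toℕ b))) (≤-reflexive (cong (2 * τ b +_) (sym W-total))))
    where
    -- The cycle is unrolled to ℕ, where index n repeats index 0; `closed` relies on this.
    t′ : ℕ → ℕ
    t′ i = t (i mod n)
    τ : Fin n → ℕ
    τ = t′ ∘ toℕ
    W : ℕ → ℕ
    W = partialSum (λ i → w (i mod n))
    W-total : ∑F w ≡ W n
    W-total = trans (∑-cong (allFin n) (cong w ∘ sym ∘ mod-toℕ)) (∑-allFin (λ i → w (i mod n)) n)
    step : ∀ i → i < n → next (i mod n) ≡ suc i mod n
    step i i<n = cong (λ j → suc j mod n) (trans (toℕ-mod i) (m<n⇒m%n≡m i<n))
    -- Along an interval, `t′` rises and falls by at most the increment of W; written additively to
    -- avoid truncated subtraction.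
    climb : ∀ i k → k + i ≤ n → t′ (k + i) + W i ≤ t′ i + W (k + i) × t′ i + W i ≤ t′ (k + i) + W (k + i)
    climb i zero    _  = ≤-refl , ≤-refl
    climb i (suc k) le with climb i k (<⇒≤ le)
    ... | h₁ , h₂ =
        linear 0 (+-mono-≤ h₁ (subst (λ x → t x ≤ t′ j + w (j mod n)) (step j le) (up (j mod n))))
          (eq₁ (t′ (suc j)) (W i) (t′ i) (W j) (t′ j) (w (j mod n)))
      , linear 0 (+-mono-≤ h₂ (subst (λ x → t′ j ≤ t x + w (j mod n)) (step j le) (down (j mod n))))
          (eq₂ (t′ (suc j)) (W i) (t′ i) (W j) (t′ j) (w (j mod n)))
      where
      j : ℕ
      j = k + i
      eq₁ : ∀ s v t W u w → s + v + (t + W + (u + w)) + 0 ≡ t + (W + w) + (u + v + s)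
      eq₁ = solve-∀
      eq₂ : ∀ s v t W u w → t + v + (u + W + (s + w)) + 0 ≡ s + (W + w) + (t + v + u)
      eq₂ = solve-∀
    segment : ∀ {i j} → i ≤ j → j ≤ n → t′ j + W i ≤ t′ i + W j × t′ i + W i ≤ t′ j + W j
    segment {i} {j} i≤j j≤n = subst (λ j → t′ j + W i ≤ t′ i + W j × t′ i + W i ≤ t′ j + W j)
      (m∸n+n≡m i≤j) (climb i (j ∸ i) (subst (_≤ n) (sym (m∸n+n≡m i≤j)) j≤n))
    closed : t′ n ≡ t′ 0
    closed = cong t (toℕ-injective (trans (toℕ-mod n) (trans (n%n≡0 n) (sym (toℕ-mod 0)))))
    -- One arc is the interval between a and b. The other passes through index 0 and is glued from
    -- two intervals at `t′ n` = `t′ 0`.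
    both : toℕ a ≤ toℕ b ⊎ toℕ b ≤ toℕ a → 2 * τ a ≤ 2 * τ b + W n
    both (inj₁ a≤b) = linear 0
      (+-mono-≤ (proj₂ (segment a≤b (<⇒≤ (toℕ<n b))))
        (+-mono-≤ (proj₁ (segment (z≤n {toℕ a}) (<⇒≤ (toℕ<n a))))
          (subst (λ u → u + W (toℕ b) ≤ τ b + W n) closed (proj₁ (segment (<⇒≤ (toℕ<n b)) ≤-refl)))))
      (eq (τ a) (W (toℕ a)) (τ b) (W (toℕ b)) (t′ 0) (W n))
      where
      eq : ∀ a v b w o W → 2 * a + (b + w + (o + v + (b + W))) + 0 ≡ 2 * b + W + (a + v + (a + 0 + (o + w)))
      eq = solve-∀
    both (inj₂ b≤a) = linear 0
      (+-mono-≤ (proj₁ (segment b≤a (<⇒≤ (toℕ<n a))))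
        (+-mono-≤ (proj₂ (segment (z≤n {toℕ b}) (<⇒≤ (toℕ<n b))))
          (subst (λ u → τ a + W (toℕ a) ≤ u + W n) closed (proj₂ (segment (<⇒≤ (toℕ<n a)) ≤-refl)))))
      (eq (τ a) (W (toℕ a)) (τ b) (W (toℕ b)) (t′ 0) (W n))
      where
      eq : ∀ a v b w o W → 2 * a + (b + v + (b + w + (o + W))) + 0 ≡ 2 * b + W + (a + w + (o + 0 + (a + v)))
      eq = solve-∀

-- The strong product layer by layer

module Product (G : Graph) (m : ℕ) (3≤n : 3 ≤ suc m) where
  open Cyclic m 3≤n public
  open Graph G
  open Counting G public

  K : Graph
  K = G ⊠ C

  module K = Counting K

  layer : VertexSet K → Fin n → VertexSet G
  layer X y x = X (x , y)

  ∑K : ∀ (f : V × Fin n → ℕ) → K.∑V f ≡ ∑V λ x → ∑F λ y → f (x , y)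
  ∑K = ∑-cartesianProduct vertices (allFin n)

  card-layers : ∀ X → K.∣ X ∣ ≡ ∑F λ y → ∣ layer X y ∣
  card-layers X = trans (∑K (⟦_⟧ ∘ X)) (∑-swap vertices (allFin n) λ x y → ⟦ X (x , y) ⟧)

  -- By irreflexivity of both factors the three clauses of adjacency exclude one another, so the
  -- indicator of their disjunction is a sum.
  adjacency-split : ∀ x y x′ y′ →
    K.α (x , y) (x′ , y′) ≡ ⟦ does (x ≟ x′) ⟧ * β y y′ + (α x x′ * ⟦ does (y ≟ᶠ y′) ⟧ + α x x′ * β y y′)
  adjacency-split x y x′ y′ =
    split (does (x ≟ x′)) (does (y ≟ᶠ y′)) (does (adj? x x′)) (does (Graph.adj? C y y′)) xs ys
    where
    xs : does (x ≟ x′) ∧ does (adj? x x′) ≡ false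
    xs with x ≟ x′
    ... | yes refl = dec-false (adj? x x) irrefl
    ... | no _     = refl
    ys : does (y ≟ᶠ y′) ∧ does (Graph.adj? C y y′) ≡ false
    ys with y ≟ᶠ y′
    ... | yes refl = dec-false (Graph.adj? C y y) (Graph.irrefl C {y})
    ... | no _     = refl
    split : ∀ a b c d → a ∧ c ≡ false → b ∧ d ≡ false →
      ⟦ (a ∧ d) ∨ ((b ∧ c) ∨ (c ∧ d)) ⟧ ≡ ⟦ a ⟧ * ⟦ d ⟧ + (⟦ c ⟧ * ⟦ b ⟧ + ⟦ c ⟧ * ⟦ d ⟧)
    split true  true  false false _ _ = refl
    split true  false false false _ _ = refl
    split true  false false true  _ _ = refl
    split false true  false false _ _ = refl
    split false true  true  false _ _ = refl
    split false false false false _ _ = refl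
    split false false true  false _ _ = refl
    split false false false true  _ _ = refl
    split false false true  true  _ _ = refl

  -- The neighbours of (x, y) are two in the fibre over x and three in the fibre over each neighbour
  -- of x.
  neighbourhood-∑ : ∀ x y (g : V × Fin n → ℕ) →
    K.∑V (λ q → K.α (x , y) q * g q) ≡
    g (x , next y) + g (x , prev y)
      + ∑V (λ x′ → α x x′ * (g (x′ , y) + (g (x′ , next y) + g (x′ , prev y))))
  neighbourhood-∑ x y g = begin
    K.∑V (λ q → K.α (x , y) q * g q)
      ≡⟨ ∑K (λ q → K.α (x , y) q * g q) ⟩
    ∑V (λ x′ → ∑F λ y′ → K.α (x , y) (x′ , y′) * g (x′ , y′))
      ≡⟨ ∑-cong vertices fibre ⟩
    ∑V (λ x′ → ⟦ does (x ≟ x′) ⟧ * vertical x′ + α x x′ * (g (x′ , y) + vertical x′))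
      ≡⟨ ∑-distrib-+ vertices (λ x′ → ⟦ does (x ≟ x′) ⟧ * vertical x′) _ ⟩
    ∑V (λ x′ → ⟦ does (x ≟ x′) ⟧ * vertical x′) + ∑V (λ x′ → α x x′ * (g (x′ , y) + vertical x′))
      ≡⟨ cong (_+ ∑V (λ x′ → α x x′ * (g (x′ , y) + vertical x′))) (∑-≟ _≟_ x vertical unique (complete x)) ⟩
    vertical x + ∑V (λ x′ → α x x′ * (g (x′ , y) + vertical x′)) ∎
    where
    open ≡-Reasoning
    vertical : V → ℕ
    vertical x′ = g (x′ , next y) + g (x′ , prev y)
    expand : ∀ a b c d g → (a * d + (c * b + c * d)) * g ≡ a * (d * g) + (c * (b * g) + c * (d * g))
    expand = solve-∀
    fibre : ∀ x′ → ∑F (λ y′ → K.α (x , y) (x′ , y′) * g (x′ , y′))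
                   ≡ ⟦ does (x ≟ x′) ⟧ * vertical x′ + α x x′ * (g (x′ , y) + vertical x′)
    fibre x′ = begin
      ∑F (λ y′ → K.α (x , y) (x′ , y′) * g (x′ , y′))
        ≡⟨ ∑-cong (allFin n) (λ y′ → trans (cong (_* g (x′ , y′)) (adjacency-split x y x′ y′))
             (expand ⟦ does (x ≟ x′) ⟧ ⟦ does (y ≟ᶠ y′) ⟧ (α x x′) (β y y′) (g (x′ , y′)))) ⟩
      ∑F (λ y′ → i * βg y′ + (a * δg y′ + a * βg y′))
        ≡⟨ ∑-distrib-+ (allFin n) (λ y′ → i * βg y′) (λ y′ → a * δg y′ + a * βg y′) ⟩
      ∑F (λ y′ → i * βg y′) + ∑F (λ y′ → a * δg y′ + a * βg y′)
        ≡⟨ cong (∑F (λ y′ → i * βg y′) +_) (∑-distrib-+ (allFin n) (λ y′ → a * δg y′) (λ y′ → a * βg y′)) ⟩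
      ∑F (λ y′ → i * βg y′) + (∑F (λ y′ → a * δg y′) + ∑F (λ y′ → a * βg y′))
        ≡⟨ cong₂ _+_ (∑-distribˡ-* (allFin n) i βg) (cong₂ _+_ (∑-distribˡ-* (allFin n) a δg) (∑-distribˡ-* (allFin n) a βg)) ⟩
      i * ∑F βg + (a * ∑F δg + a * ∑F βg)
        ≡⟨ cong₂ (λ u v → i * u + (a * v + a * u)) (∑-β y (λ y′ → g (x′ , y′)))
             (∑-≟ _≟ᶠ_ y (λ y′ → g (x′ , y′)) (allFin⁺ n) (∈-allFin y)) ⟩
      i * vertical x′ + (a * g (x′ , y) + a * vertical x′)
        ≡⟨ cong (i * vertical x′ +_) (sym (*-distribˡ-+ a (g (x′ , y)) (vertical x′))) ⟩
      i * vertical x′ + a * (g (x′ , y) + vertical x′) ∎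
      where
      i a : ℕ
      i = ⟦ does (x ≟ x′) ⟧
      a = α x x′
      βg δg : Fin n → ℕ
      βg y′ = β y y′ * g (x′ , y′)
      δg y′ = ⟦ does (y ≟ᶠ y′) ⟧ * g (x′ , y′)

  degree-K : ∀ x y → Graph.degree K (x , y) ≡ 3 * degree x + 2
  degree-K x y = begin
    Graph.degree K (x , y)                 ≡⟨ K.degree-∑ (x , y) ⟩
    K.∑V (λ q → K.α (x , y) q)             ≡⟨ ∑-cong (Graph.vertices K) (λ q → *-identityʳ (K.α (x , y) q)) ⟨
    K.∑V (λ q → K.α (x , y) q * 1)         ≡⟨ neighbourhood-∑ x y (λ _ → 1) ⟩
    2 + ∑V (λ x′ → α x x′ * 3)             ≡⟨ cong (2 +_) (∑-distribʳ-* vertices 3 (α x)) ⟩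
    2 + ∑V (α x) * 3                       ≡⟨ cong (λ k → 2 + k * 3) (sym (degree-∑ x)) ⟩
    2 + degree x * 3                       ≡⟨ commute (degree x) ⟩
    3 * degree x + 2                       ∎
    where
    open ≡-Reasoning
    commute : ∀ k → 2 + k * 3 ≡ 3 * k + 2
    commute = solve-∀

  -- Edges between layers are met once from below and once from above. Reindexing by `∑-prev`
  -- identifies the two contributions, whence the factor 2.
  boundary-layers : ∀ X → let L = layer X in
    2 * boundarySize K X ≡
    ∑F (λ y → D (L y) (L y)) + 2 * (∑F (λ y → diff (L y) (L (next y))) + ∑F (λ y → D (L y) (L (next y))))
  boundary-layers X = begin
    2 * boundarySize K X
      ≡⟨ K.boundary-D X ⟩
    K.D X X
      ≡⟨ ∑K (λ p → K.∑V λ q → K.α p q * ⟦ X p xor X q ⟧) ⟩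
    ∑V (λ x → ∑F λ y → K.∑V λ q → K.α (x , y) q * ⟦ X (x , y) xor X q ⟧)
      ≡⟨ ∑-swap vertices (allFin n) (λ x y → K.∑V λ q → K.α (x , y) q * ⟦ X (x , y) xor X q ⟧) ⟩
    ∑F (λ y → ∑V λ x → K.∑V λ q → K.α (x , y) q * ⟦ X (x , y) xor X q ⟧)
      ≡⟨ ∑-cong (allFin n) local ⟩
    ∑F (λ y → (diff (L y) (L (next y)) + diff (L y) (L (prev y)))
            + (D (L y) (L y) + (D (L y) (L (next y)) + D (L y) (L (prev y)))))
      ≡⟨ distribute ⟩
    (∑F v + ∑F v⁻) + (∑F h + (∑F c + ∑F c⁻))
      ≡⟨ cong₂ (λ i j → (∑F v + i) + (∑F h + (∑F c + j))) v⁻≡v c⁻≡c ⟩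
    (∑F v + ∑F v) + (∑F h + (∑F c + ∑F c))
      ≡⟨ collect (∑F v) (∑F h) (∑F c) ⟩
    ∑F h + 2 * (∑F v + ∑F c) ∎
    where
    open ≡-Reasoning
    L : Fin n → VertexSet G
    L = layer X
    v v⁻ h c c⁻ : Fin n → ℕ
    v  y = diff (L y) (L (next y))
    v⁻ y = diff (L y) (L (prev y))
    h  y = D (L y) (L y)
    c  y = D (L y) (L (next y))
    c⁻ y = D (L y) (L (prev y))
    collect : ∀ v h c → (v + v) + (h + (c + c)) ≡ h + 2 * (v + c)
    collect = solve-∀
    local : ∀ y → ∑V (λ x → K.∑V λ q → K.α (x , y) q * ⟦ X (x , y) xor X q ⟧)
                  ≡ (v y + v⁻ y) + (h y + (c y + c⁻ y))
    local y = begin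
      ∑V (λ x → K.∑V λ q → K.α (x , y) q * ⟦ X (x , y) xor X q ⟧)
        ≡⟨ ∑-cong vertices (λ x → neighbourhood-∑ x y (λ q → ⟦ X (x , y) xor X q ⟧)) ⟩
      ∑V (λ x → (⟦ L y x xor L (next y) x ⟧ + ⟦ L y x xor L (prev y) x ⟧)
              + ∑V (λ x′ → α x x′ * (⟦ L y x xor L y x′ ⟧ + (⟦ L y x xor L (next y) x′ ⟧ + ⟦ L y x xor L (prev y) x′ ⟧))))
        ≡⟨ ∑-distrib-+ vertices (λ x → ⟦ L y x xor L (next y) x ⟧ + ⟦ L y x xor L (prev y) x ⟧) _ ⟩
      ∑V (λ x → ⟦ L y x xor L (next y) x ⟧ + ⟦ L y x xor L (prev y) x ⟧)
        + Q (λ x x′ → ⟦ L y x xor L y x′ ⟧ + (⟦ L y x xor L (next y) x′ ⟧ + ⟦ L y x xor L (prev y) x′ ⟧))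
        ≡⟨ cong₂ _+_ (∑-distrib-+ vertices (λ x → ⟦ L y x xor L (next y) x ⟧) _)
             (trans (Q-+ (λ x x′ → ⟦ L y x xor L y x′ ⟧) _)
               (cong (h y +_) (Q-+ (λ x x′ → ⟦ L y x xor L (next y) x′ ⟧) (λ x x′ → ⟦ L y x xor L (prev y) x′ ⟧)))) ⟩
      (v y + v⁻ y) + (h y + (c y + c⁻ y)) ∎
    distribute : ∑F (λ y → (v y + v⁻ y) + (h y + (c y + c⁻ y))) ≡ (∑F v + ∑F v⁻) + (∑F h + (∑F c + ∑F c⁻))
    distribute = trans (∑-distrib-+ (allFin n) (λ y → v y + v⁻ y) (λ y → h y + (c y + c⁻ y)))
      (cong₂ _+_ (∑-distrib-+ (allFin n) v v⁻)
        (trans (∑-distrib-+ (allFin n) h (λ y → c y + c⁻ y)) (cong (∑F h +_) (∑-distrib-+ (allFin n) c c⁻))))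
    v⁻≡v : ∑F v⁻ ≡ ∑F v
    v⁻≡v = trans (∑-cong (allFin n) λ y → trans (diff-sym (L y) (L (prev y)))
      (cong (λ z → diff (L (prev y)) (L z)) (sym (next-prev y)))) (∑-prev v)
    c⁻≡c : ∑F c⁻ ≡ ∑F c
    c⁻≡c = trans (∑-cong (allFin n) λ y → trans (D-sym (L y) (L (prev y)))
      (cong (λ z → D (L (prev y)) (L z)) (sym (next-prev y)))) (∑-prev c)

-- Lower bound when both sides have at least four vertices

∑-below-length : ∀ (xs : List A) (f : A → ℕ) → ∑ xs f < length xs → ∃ λ x → f x ≡ 0
∑-below-length (x ∷ xs) f lt with f x in eq
... | zero  = x , eq
... | suc k = ∑-below-length xs f (≤-trans (s≤s (m≤n+m (∑ xs f) k)) (≤-pred lt))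

∑-exceeds : ∀ (xs : List A) (f g : A → ℕ) → ∑ xs g < ∑ xs f → ∃ λ x → g x < f x
∑-exceeds (x ∷ xs) f g lt with g x <? f x
... | yes gx<fx = x , gx<fx
... | no  gx≮fx = ∑-exceeds xs f g (+-cancelˡ-< (f x) _ _ (≤-<-trans (+-monoˡ-≤ _ (≮⇒≥ gx≮fx)) lt))

module LowerBound (G : Graph) (d : ℕ)
  (d≤degree : ∀ x → d ≤ Graph.degree G x)
  (d≤boundary : ∀ A {x y} → A x ≡ true → A y ≡ false → d ≤ boundarySize G A)
  (2≤d : 2 ≤ d) (d≤order : d ≤ Graph.order G) (5≤order : 5 ≤ Graph.order G)
  (m : ℕ) (4≤n : 4 ≤ suc m) where
  open LayerBounds G d d≤degree d≤boundary 2≤d d≤order 5≤order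
  open Product G m (<⇒≤ 4≤n)

  degree-K≥ : ∀ p → 3 * d + 2 ≤ Graph.degree K p
  degree-K≥ (x , y) = ≤-trans (+-monoˡ-≤ 2 (*-monoʳ-≤ 3 (d≤degree x))) (≤-reflexive (sym (degree-K x y)))

  -- Degree counting: the degree sum of X is at least k (3d + 2), and at most k (k - 1) of it is
  -- spent on edges inside X.
  sparse : ∀ X k → K.∣ X ∣ ≡ k → k * (3 * d + 2) + k ≤ boundarySize K X + k * k
  sparse X k refl = linear 0 (+-mono-≤ (K.μ-lower degree-K≥ X) (K.e+card≤card² X))
    (trans (cong (λ u → s * (3 * d + 2) + s + (u + s * s) + 0) (sym (K.boundary+e X)))
      (eq (s * (3 * d + 2)) s (s * s) (boundarySize K X) (K.e X)))
    where
    s : ℕ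
    s = K.∣ X ∣
    eq : ∀ t s q b e → t + s + (b + e + q) + 0 ≡ b + q + (t + (e + s))
    eq = solve-∀

  module _ (X : VertexSet K) where

    private
      b : ℕ
      b = boundarySize K X
      L : Fin n → VertexSet G
      L = layer X
      π : Fin n → ℕ
      π y = properness (kind (L y))
      h v c δ : Fin n → ℕ
      h y = D (L y) (L y)
      v y = diff (L y) (L (next y))
      c y = D (L y) (L (next y))
      δ y = distance (π y) (π (next y))

    properLayers : ℕ
    properLayers = ∑F π

    -- Each layer is the first member of one pair and the second of another, which completes the
    -- halves of its inner edges.
    weight-∑ : ∑F (λ y → weight (L y) (L (next y))) ≡ 4 * b
    weight-∑ = begin
      ∑F (λ y → 4 * v y + (4 * c y + (h y + h (next y))))
        ≡⟨ ∑-distrib-+ (allFin n) (λ y → 4 * v y) _ ⟩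
      ∑F (λ y → 4 * v y) + ∑F (λ y → 4 * c y + (h y + h (next y)))
        ≡⟨ cong₂ _+_ (∑-distribˡ-* (allFin n) 4 v) (∑-distrib-+ (allFin n) (λ y → 4 * c y) _) ⟩
      4 * ∑F v + (∑F (λ y → 4 * c y) + ∑F (λ y → h y + h (next y)))
        ≡⟨ cong (4 * ∑F v +_) (cong₂ _+_ (∑-distribˡ-* (allFin n) 4 c)
             (trans (∑-distrib-+ (allFin n) h (h ∘ next)) (cong (∑F h +_) (∑-next h)))) ⟩
      4 * ∑F v + (4 * ∑F c + (∑F h + ∑F h))
        ≡⟨ collect (∑F v) (∑F c) (∑F h) ⟩
      2 * (∑F h + 2 * (∑F v + ∑F c))
        ≡⟨ cong (2 *_) (sym (boundary-layers X)) ⟩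
      2 * (2 * b)
        ≡⟨ *-assoc 2 2 b ⟨
      4 * b ∎
      where
      open ≡-Reasoning
      collect : ∀ v c h → 4 * v + (4 * c + (h + h)) ≡ 2 * (h + 2 * (v + c))
      collect = solve-∀

    properLayers-bound : 12 * d * properLayers + 4 * ∑F δ ≤ 4 * b
    properLayers-bound = begin
      12 * d * ∑F π + 4 * ∑F δ
        ≡⟨ double d (∑F π) (∑F δ) ⟩
      6 * d * (∑F π + ∑F π) + 4 * ∑F δ
        ≡⟨ cong (λ u → 6 * d * u + 4 * ∑F δ)
             (trans (cong (∑F π +_) (sym (∑-next π))) (sym (∑-distrib-+ (allFin n) π (π ∘ next)))) ⟩
      6 * d * ∑F (λ y → π y + π (next y)) + 4 * ∑F δ
        ≡⟨ cong₂ _+_ (sym (∑-distribˡ-* (allFin n) (6 * d) _)) (sym (∑-distribˡ-* (allFin n) 4 δ)) ⟩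
      ∑F (λ y → 6 * d * (π y + π (next y))) + ∑F (λ y → 4 * δ y)
        ≡⟨ sym (∑-distrib-+ (allFin n) (λ y → 6 * d * (π y + π (next y))) (λ y → 4 * δ y)) ⟩
      ∑F (λ y → 6 * d * (π y + π (next y)) + 4 * δ y)
        ≤⟨ ∑-mono (allFin n) (λ y → weight-bound (kind (L y)) (kind (L (next y)))) ⟩
      ∑F (λ y → weight (L y) (L (next y)))
        ≡⟨ weight-∑ ⟩
      4 * b ∎
      where
      open ≤-Reasoning
      double : ∀ d p q → 12 * d * p + 4 * q ≡ 6 * d * (p + p) + 4 * q
      double = solve-∀

    properLayers≥4 : 4 ≤ properLayers → 9 * d + 2 ≤ b
    properLayers≥4 4≤p = *-cancelˡ-≤ 4 (linear (8 * d + 4 * ∑F δ)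
      (+-mono-≤ (*-monoʳ-≤ 4 2≤d) (+-mono-≤ (*-monoʳ-≤ (12 * d) 4≤p) properLayers-bound))
      (eq d properLayers (∑F δ) b))
      where
      eq : ∀ d p q b → 4 * (9 * d + 2) + (4 * d + (12 * d * p + 4 * b)) + (8 * d + 4 * q)
                       ≡ 4 * b + (4 * 2 + (12 * d * 4 + (12 * d * p + 4 * q)))
      eq = solve-∀

    improperLayer : properLayers ≤ 3 → ∃ λ y → π y ≡ 0
    improperLayer p≤3 = ∑-below-length (allFin n) π
      (subst (properLayers <_) (sym (length-tabulate {n = n} id)) (≤-trans (s≤s p≤3) 4≤n))

    -- As n ≥ 4, some layer is improper, so `π` takes both values 0 and 1 and has total variation at
    -- least 2. The result 36d + 8 is exactly 4 (9d + 2).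
    properLayers≡3 : properLayers ≡ 3 → 9 * d + 2 ≤ b
    properLayers≡3 p≡3 with ∑-positive (allFin n) π (subst (1 ≤_) (sym p≡3) (s≤s z≤n)) | improperLayer (≤-reflexive p≡3)
    ... | y , 1≤πy | z , πz≡0 = *-cancelˡ-≤ 4 (linear 0
      (+-mono-≤ (*-monoʳ-≤ 4 (≤-trans (*-monoʳ-≤ 2 1≤πy) oscillation)) properLayers-bound)
      (trans (eq d (∑F δ) b) (cong (λ p → 4 * b + (4 * (2 * 1) + (12 * d * p + 4 * ∑F δ))) (sym p≡3))))
      where
      oscillation : 2 * π y ≤ ∑F δ
      oscillation = subst (λ k → 2 * π y ≤ 2 * k + ∑F δ) πz≡0
        (variation π δ (λ u → lower (π u) (π (next u))) (λ u → upper (π u) (π (next u))) y z)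
        where
        lower : ∀ i j → i ≤ j + distance i j
        lower i j = ≤-trans (m≤n+m∸n i j) (+-monoʳ-≤ j (m≤m+n (i ∸ j) (j ∸ i)))
        upper : ∀ i j → j ≤ i + distance i j
        upper i j = ≤-trans (m≤n+m∸n j i) (+-monoʳ-≤ i (m≤n+m (j ∸ i) (i ∸ j)))
      eq : ∀ d q b → 4 * (9 * d + 2) + (4 * q + 4 * b) + 0 ≡ 4 * b + (4 * (2 * 1) + (12 * d * 3 + 4 * q))
      eq = solve-∀

    module _ (y₀ : Fin n) (y₀-empty : ∀ x → L y₀ x ≡ false) where

      -- Degree sum and cardinality of the layers vanish at `y₀`. By `variation`, both arcs from
      -- there to y must pay for their values at y, in diagonal and in vertical edges respectively.
      tall : ∀ k y → k ≤ ∣ L y ∣ → 2 * (k * d) ≤ ∑F c × 2 * k ≤ ∑F v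
      tall k y k≤ =
          ≤-trans (*-monoʳ-≤ 2 (≤-trans (*-monoˡ-≤ d k≤) (μ-lower d≤degree (L y))))
            (subst (λ u → 2 * μ (L y) ≤ 2 * u + ∑F c) (μ-empty (L y₀) y₀-empty)
              (variation (μ ∘ L) c (λ u → μ-lipschitz (L u) (L (next u)))
                (λ u → subst (λ r → μ (L (next u)) ≤ μ (L u) + r) (D-sym (L (next u)) (L u)) (μ-lipschitz (L (next u)) (L u)))
                y y₀))
        , ≤-trans (*-monoʳ-≤ 2 k≤)
            (subst (λ u → 2 * ∣ L y ∣ ≤ 2 * u + ∑F v) (card-empty (L y₀) y₀-empty)
              (variation (∣_∣ ∘ L) v (λ u → card-lipschitz (L u) (L (next u)))
                (λ u → subst (λ r → ∣ L (next u) ∣ ≤ ∣ L u ∣ + r) (diff-sym (L (next u)) (L u)) (card-lipschitz (L (next u)) (L u)))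
                y y₀))

      -- The 10d diagonal edges suffice, since d ≥ 2.
      height≥5 : ∀ y → 5 ≤ ∣ L y ∣ → 9 * d + 2 ≤ b
      height≥5 y 5≤ = *-cancelˡ-≤ 2 (linear (∑F h + 2 * ∑F v)
        (+-mono-≤ (*-monoʳ-≤ 2 2≤d) (*-monoʳ-≤ 2 (proj₁ (tall 5 y 5≤))))
        (trans (eq d (∑F h) (∑F v) (∑F c)) (cong (_+ (2 * 2 + 2 * (2 * (5 * d)))) (sym (boundary-layers X)))))
        where
        eq : ∀ d h v c → 2 * (9 * d + 2) + (2 * d + 2 * c) + (h + 2 * v)
                         ≡ h + 2 * (v + c) + (2 * 2 + 2 * (2 * (5 * d)))
        eq = solve-∀

      properLayers-horizontal : 2 * d * properLayers ≤ ∑F h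
      properLayers-horizontal = ≤-trans (≤-reflexive (sym (∑-distribˡ-* (allFin n) (2 * d) π)))
        (∑-mono (allFin n) λ y → horizontal (kind (L y)))
        where
        horizontal : ∀ {A} (a : Kind A) → 2 * d * properness a ≤ D A A
        horizontal {A} (proper p q) = ≤-trans (≤-reflexive (*-identityʳ (2 * d))) (2d≤D A p q)
        horizontal (empty _) = ≤-trans (≤-reflexive (*-zeroʳ (2 * d))) z≤n
        horizontal (full _)  = ≤-trans (≤-reflexive (*-zeroʳ (2 * d))) z≤n

      -- A full layer has at least five vertices, so a layer with at most four is empty or proper.
      card≤properness : ∀ {A} k → k ≤ 4 → ∣ A ∣ ≤ k → (a : Kind A) → ∣ A ∣ ≤ k * properness a
      card≤properness k _ le (proper _ _) = ≤-trans le (≤-reflexive (sym (*-identityʳ k)))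
      card≤properness {A} k _ _ (empty f) = ≤-trans (≤-reflexive (card-empty A f)) z≤n
      card≤properness {A} k k≤4 le (full f) =
        contradiction (≤-trans 5≤order (≤-trans (≤-reflexive (sym (card-full A f))) (≤-trans le k≤4))) λ
          { (s≤s (s≤s (s≤s (s≤s ())))) }

      flat : ∀ k → k ≤ 4 → (∀ y → ∣ L y ∣ ≤ k) → K.∣ X ∣ ≤ k * properLayers
      flat k k≤4 le = ≤-trans (≤-reflexive (card-layers X)) (≤-trans
        (∑-mono (allFin n) λ y → card≤properness {L y} k k≤4 (le y) (kind (L y)))
        (≤-reflexive (∑-distribˡ-* (allFin n) k π)))

      -- There are 8d diagonal and 8 vertical edges, and d more inside a proper layer.
      height≥4 : ∀ y → 4 ≤ ∣ L y ∣ → 1 ≤ properLayers → 9 * d + 2 ≤ b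
      height≥4 y 4≤ 1≤p = *-cancelˡ-≤ 2 (linear 12
        (+-mono-≤ (≤-trans (*-monoʳ-≤ (2 * d) 1≤p) properLayers-horizontal)
          (*-monoʳ-≤ 2 (+-mono-≤ (proj₂ (tall 4 y 4≤)) (proj₁ (tall 4 y 4≤)))))
        (trans (eq d (∑F h) (∑F v) (∑F c)) (cong (_+ (2 * d * 1 + 2 * (2 * 4 + 2 * (4 * d)))) (sym (boundary-layers X)))))
        where
        eq : ∀ d h v c → 2 * (9 * d + 2) + (h + 2 * (v + c)) + 12
                         ≡ h + 2 * (v + c) + (2 * d * 1 + 2 * (2 * 4 + 2 * (4 * d)))
        eq = solve-∀

      -- Here the count is 6d + 6 + 2d, which reaches 9d + 2 precisely for d ≤ 4.
      height≥3 : ∀ y → 3 ≤ ∣ L y ∣ → 2 ≤ properLayers → d ≤ 4 → 9 * d + 2 ≤ b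
      height≥3 y 3≤ 2≤p d≤4 = *-cancelˡ-≤ 2 (linear 0
        (+-mono-≤ (*-monoʳ-≤ 2 d≤4) (+-mono-≤ (≤-trans (*-monoʳ-≤ (2 * d) 2≤p) properLayers-horizontal)
          (*-monoʳ-≤ 2 (+-mono-≤ (proj₂ (tall 3 y 3≤)) (proj₁ (tall 3 y 3≤))))))
        (trans (eq d (∑F h) (∑F v) (∑F c)) (cong (_+ (2 * d + (2 * d * 2 + 2 * (2 * 3 + 2 * (3 * d))))) (sym (boundary-layers X)))))
        where
        eq : ∀ d h v c → 2 * (9 * d + 2) + (2 * 4 + (h + 2 * (v + c))) + 0
                         ≡ h + 2 * (v + c) + (2 * d + (2 * d * 2 + 2 * (2 * 3 + 2 * (3 * d))))
        eq = solve-∀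

      withEmptyLayer : 4 ≤ K.∣ X ∣ → properLayers ≤ 2 → 9 * d + 2 ≤ b
      withEmptyLayer 4≤s p≤2 with any? (λ y → 5 ≤? ∣ L y ∣)
      ... | yes (y , 5≤) = height≥5 y 5≤
      ... | no  ≱5 with any? (λ y → 4 ≤? ∣ L y ∣)
      ...   | yes (y , 4≤) = height≥4 y 4≤ (positive (≤-trans 4≤s (flat 4 ≤-refl λ z → ≤-pred (≰⇒> λ 5≤ → ≱5 (z , 5≤)))))
        where
        positive : ∀ {p} → 4 ≤ 4 * p → 1 ≤ p
        positive {suc _} _ = s≤s z≤n
      ...   | no  ≱4 = low K.∣ X ∣ refl 4≤s
        where
        ≤3 : ∀ y → ∣ L y ∣ ≤ 3
        ≤3 y = ≤-pred (≰⇒> λ 4≤ → ≱4 (y , 4≤))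
        -- At most two proper layers with at most three vertices each leave |X| ≤ 6. Degree counting
        -- gives 12d - 4 for four vertices and 15d - 10 for five, enough as d ≥ 2. For six it gives
        -- 18d - 18, too little at d = 2; small d is left to `height≥3`.
        low : ∀ s → K.∣ X ∣ ≡ s → 4 ≤ s → 9 * d + 2 ≤ b
        low 0 _ ()
        low 1 _ (s≤s ())
        low 2 _ (s≤s (s≤s ()))
        low 3 _ (s≤s (s≤s (s≤s ())))
        low 4 s≡ _ = linear 0 (+-mono-≤ (*-monoʳ-≤ 3 2≤d) (sparse X 4 s≡)) (eq d b)
          where
          eq : ∀ d b → 9 * d + 2 + (3 * d + (b + 4 * 4)) + 0 ≡ b + (3 * 2 + (4 * (3 * d + 2) + 4))
          eq = solve-∀
        low 5 s≡ _ = linear 0 (+-mono-≤ (*-monoʳ-≤ 6 2≤d) (sparse X 5 s≡)) (eq d b)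
          where
          eq : ∀ d b → 9 * d + 2 + (6 * d + (b + 5 * 5)) + 0 ≡ b + (6 * 2 + (5 * (3 * d + 2) + 5))
          eq = solve-∀
        low s@(suc (suc (suc (suc (suc (suc r)))))) s≡ _ with any? (λ y → 3 ≤? ∣ L y ∣)
        ... | no ≱3 = contradiction (≤-trans (≤-trans 6≤s (flat 2 (s≤s (s≤s z≤n)) λ y → ≤-pred (≰⇒> λ 3≤ → ≱3 (y , 3≤))))
                        (*-monoʳ-≤ 2 p≤2)) λ { (s≤s (s≤s (s≤s (s≤s ())))) }
          where
          6≤s : 6 ≤ K.∣ X ∣
          6≤s = ≤-trans (m≤m+n 6 r) (≤-reflexive (sym s≡))
        ... | yes (y , 3≤) with d ≤? 4
        ...   | yes d≤4 = height≥3 y 3≤ (two (≤-trans 6≤s (flat 3 (s≤s (s≤s (s≤s z≤n))) ≤3))) d≤4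
          where
          6≤s : 6 ≤ K.∣ X ∣
          6≤s = ≤-trans (m≤m+n 6 r) (≤-reflexive (sym s≡))
          two : ∀ {p} → 6 ≤ 3 * p → 2 ≤ p
          two {1} (s≤s (s≤s (s≤s ())))
          two {suc (suc _)} _ = s≤s (s≤s z≤n)
        ...   | no d≰4 = linear 25 (+-mono-≤ (*-monoʳ-≤ 9 (≰⇒> d≰4)) (sparse X 6 s≡6)) (eq d b)
          where
          s≡6 : K.∣ X ∣ ≡ 6
          s≡6 = ≤-antisym (≤-trans (flat 3 (s≤s (s≤s (s≤s z≤n))) ≤3) (*-monoʳ-≤ 3 p≤2))
                  (≤-trans (m≤m+n 6 r) (≤-reflexive (sym s≡)))
          eq : ∀ d b → 9 * d + 2 + (9 * d + (b + 6 * 6)) + 25 ≡ b + (9 * 5 + (6 * (3 * d + 2) + 6))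
          eq = solve-∀

  properness-complement : ∀ {A} (a : Kind A) (a′ : Kind (complement A)) → properness a′ ≡ properness a
  properness-complement (proper _ _) (proper _ _) = refl
  properness-complement (proper {y = y} _ q) (empty f) = contradiction (trans (sym (cong not q)) (f y)) λ ()
  properness-complement (proper {x = x} p _) (full f) = contradiction (trans (sym (cong not p)) (f x)) λ ()
  properness-complement (empty f) (proper {y = y} _ q) = contradiction (trans (sym (cong not (f y))) q) λ ()
  properness-complement (empty _) (empty _) = refl
  properness-complement (empty _) (full _)  = refl
  properness-complement (full f) (proper {x = x} p _) = contradiction (trans (sym (cong not (f x))) p) λ ()
  properness-complement (full _) (empty _) = refl
  properness-complement (full _) (full _)  = refl

  largeSet-bound : ∀ X → 4 ≤ K.∣ X ∣ → 4 ≤ K.∣ complement X ∣ → 9 * d + 2 ≤ boundarySize K X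
  largeSet-bound X 4≤s 4≤s′ with 4 ≤? properLayers X | properLayers X ≟ⁿ 3
  ... | yes 4≤p | _ = properLayers≥4 X 4≤p
  ... | no _ | yes p≡3 = properLayers≡3 X p≡3
  ... | no 4≰p | no p≢3 = fewProperLayers (improperLayer X (≤-trans p≤2 (n≤1+n 2)))
    where
    p≤2 : properLayers X ≤ 2
    p≤2 = ≤-pred (≤∧≢⇒< (≤-pred (≰⇒> 4≰p)) p≢3)
    fewProperLayers : (∃ λ y → properness (kind (layer X y)) ≡ 0) → 9 * d + 2 ≤ boundarySize K X
    fewProperLayers (y , eq) with kind (layer X y) | eq
    ... | proper _ _ | ()
    ... | empty f | _ = withEmptyLayer X y f 4≤s p≤2
    -- Complementing empties this layer and preserves the boundary and the proper layers.
    ... | full f  | _ = subst (9 * d + 2 ≤_) (K.boundary-complement X)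
      (withEmptyLayer (complement X) y (cong not ∘ f) 4≤s′
        (≤-trans (≤-reflexive (∑-cong (allFin n) λ z →
          properness-complement (kind (layer X z)) (kind (layer (complement X) z)))) p≤2))

-- Three-vertex sets and restricted edge-cuts

module Triples (G : Graph) where
  open Graph G
  open Counting G

  -- X = {u, v, w} with u, v, w distinct, as a summation rule.
  IsTriple : VertexSet G → V → V → V → Set
  IsTriple X u v w = ∀ (f : V → ℕ) → ∑V (λ z → ⟦ X z ⟧ * f z) ≡ f u + (f v + f w)

  triple-card : ∀ {X u v w} → IsTriple X u v w → ∣ X ∣ ≡ 3
  triple-card {X} {u} {v} {w} h = trans (∑-cong vertices λ z → sym (*-identityʳ ⟦ X z ⟧)) (h λ _ → 1)

  -- `boundary+e` for a triple: the summation rule evaluates `μ` in one application and `e` in two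
  -- nested ones.
  triple-boundary : ∀ {X u v w} → IsTriple X u v w →
    boundarySize G X + 2 * (α u v + (α u w + α v w)) ≡ degree u + (degree v + degree w)
  triple-boundary {X} {u} {v} {w} h = trans (cong (boundarySize G X +_) (sym inner)) (trans (boundary+e X) (h degree))
    where
    swap-factor : ∀ k a b → k * ⟦ a ∧ b ⟧ ≡ ⟦ a ⟧ * (⟦ b ⟧ * k)
    swap-factor k a b = trans (cong (k *_) (sym (⟦⟧-∧ a b))) (assoc k ⟦ a ⟧ ⟦ b ⟧)
      where
      assoc : ∀ k a b → k * (a * b) ≡ a * (b * k)
      assoc = solve-∀
    row : V → ℕ
    row x = α x u + (α x v + α x w)
    inner : e X ≡ 2 * (α u v + (α u w + α v w))
    inner = begin
      e X
        ≡⟨ ∑-cong vertices (λ x → trans (∑-cong vertices λ y → swap-factor (α x y) (X x) (X y))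
             (∑-distribˡ-* vertices ⟦ X x ⟧ (λ y → ⟦ X y ⟧ * α x y))) ⟩
      ∑V (λ x → ⟦ X x ⟧ * ∑V (λ y → ⟦ X y ⟧ * α x y))
        ≡⟨ ∑-cong vertices (λ x → cong (⟦ X x ⟧ *_) (h (α x))) ⟩
      ∑V (λ x → ⟦ X x ⟧ * row x)
        ≡⟨ h row ⟩
      row u + (row v + row w)
        ≡⟨ cong₂ _+_ (cong (_+ (α u v + α u w)) (α-diag u))
             (cong₂ _+_ (cong₂ (λ i j → i + (j + α v w)) (α-sym v u) (α-diag v))
               (cong₂ (λ i j → i + j) (α-sym w u) (cong₂ _+_ (α-sym w v) (α-diag w)))) ⟩
      (α u v + α u w) + ((α u v + α v w) + (α u w + (α v w + 0)))
        ≡⟨ double (α u v) (α u w) (α v w) ⟩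
      2 * (α u v + (α u w + α v w)) ∎
      where
      open ≡-Reasoning
      double : ∀ a b c → (a + b) + ((a + c) + (b + (c + 0))) ≡ 2 * (a + (b + c))
      double = solve-∀

  three-triple : ∀ X → ∣ X ∣ ≡ 3 → ∃ λ u → ∃ λ v → ∃ λ w → IsTriple X u v w
  three-triple X eq = go (filter (T? ∘ X) vertices) refl (trans (card-∑ X) eq)
    where
    go : ∀ F → filter (T? ∘ X) vertices ≡ F → length F ≡ 3 → ∃ λ u → ∃ λ v → ∃ λ w → IsTriple X u v w
    go (u ∷ v ∷ w ∷ []) F≡ _ = u , v , w , λ f → trans (sym (∑-filter (T? ∘ X) vertices f))
      (trans (cong (λ F → ∑ F f) F≡) (cong (λ k → f u + (f v + k)) (+-identityʳ (f w))))
    go [] _ ()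
    go (_ ∷ []) _ ()
    go (_ ∷ _ ∷ []) _ ()
    go (_ ∷ _ ∷ _ ∷ _ ∷ _) _ ()

  α-adjacent : ∀ {x y} → Adj x y → α x y ≡ 1
  α-adjacent {x} {y} adj = cong ⟦_⟧ (dec-true (adj? x y) adj)

  α-nonadjacent : ∀ {x y} → ¬ Adj x y → α x y ≡ 0
  α-nonadjacent {x} {y} ¬adj = cong ⟦_⟧ (dec-false (adj? x y) ¬adj)

  nonTriangle-edges : ∀ {u v w} → ¬ (Adj u v × Adj u w × Adj v w) → α u v + (α u w + α v w) ≤ 2
  nonTriangle-edges {u} {v} {w} ¬triangle with adj? u v | adj? u w | adj? v w
  ... | yes p | yes q | yes r = ⊥-elim (¬triangle (p , q , r))
  ... | yes _ | yes _ | no _  = ≤-refl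
  ... | yes _ | no _  | yes _ = ≤-refl
  ... | yes _ | no _  | no _  = s≤s z≤n
  ... | no _  | yes _ | yes _ = ≤-refl
  ... | no _  | yes _ | no _  = s≤s z≤n
  ... | no _  | no _  | yes _ = s≤s z≤n
  ... | no _  | no _  | no _  = z≤n

  ⟦_,_,_⟧ᵗ : V → V → V → VertexSet G
  ⟦ u , v , w ⟧ᵗ z = does (u ≟ z) ∨ (does (v ≟ z) ∨ does (w ≟ z))

  module _ {u v w : V} (u≢v : u ≢ v) (u≢w : u ≢ w) (v≢w : v ≢ w) where

    isTriple : IsTriple ⟦ u , v , w ⟧ᵗ u v w
    isTriple f = begin
      ∑V (λ z → ⟦ does (u ≟ z) ∨ (does (v ≟ z) ∨ does (w ≟ z)) ⟧ * f z)
        ≡⟨ ∑-cong vertices split ⟩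
      ∑V (λ z → U z + (V′ z + W z))
        ≡⟨ trans (∑-distrib-+ vertices U (λ z → V′ z + W z)) (cong (∑V U +_) (∑-distrib-+ vertices V′ W)) ⟩
      ∑V U + (∑V V′ + ∑V W)
        ≡⟨ cong₂ _+_ (∑-≟ _≟_ u f unique (complete u))
             (cong₂ _+_ (∑-≟ _≟_ v f unique (complete v)) (∑-≟ _≟_ w f unique (complete w))) ⟩
      f u + (f v + f w) ∎
      where
      open ≡-Reasoning
      U V′ W : V → ℕ
      U z  = ⟦ does (u ≟ z) ⟧ * f z
      V′ z = ⟦ does (v ≟ z) ⟧ * f z
      W z  = ⟦ does (w ≟ z) ⟧ * f z
      split : ∀ z → ⟦ does (u ≟ z) ∨ (does (v ≟ z) ∨ does (w ≟ z)) ⟧ * f z ≡ U z + (V′ z + W z)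
      split z with u ≟ z | v ≟ z | w ≟ z
      ... | yes refl | yes v≡u | _ = ⊥-elim (u≢v (sym v≡u))
      ... | yes refl | no _ | yes w≡u = ⊥-elim (u≢w (sym w≡u))
      ... | yes refl | no _ | no _ = sym (+-identityʳ (f z + 0))
      ... | no _ | yes refl | yes w≡v = ⊥-elim (v≢w (sym w≡v))
      ... | no _ | yes refl | no _ = sym (+-identityʳ (f z + 0))
      ... | no _ | no _ | yes _ = refl
      ... | no _ | no _ | no _ = refl

  triple-member : ∀ {u v w z} → T (⟦ u , v , w ⟧ᵗ z) → u ≡ z ⊎ v ≡ z ⊎ w ≡ z
  triple-member {u} {v} {w} {z} t with u ≟ z | v ≟ z | w ≟ z
  ... | yes p | _ | _ = inj₁ p
  ... | no _ | yes p | _ = inj₂ (inj₁ p)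
  ... | no _ | no _ | yes p = inj₂ (inj₂ p)
  triple-member () | no _ | no _ | no _

  T⁺ : ∀ {b} → b ≡ true → T b
  T⁺ refl = tt

  triple-member₁ : ∀ u v w → T (⟦ u , v , w ⟧ᵗ u)
  triple-member₁ u v w rewrite dec-true (u ≟ u) refl = tt

  triple-member₂ : ∀ u v w → T (⟦ u , v , w ⟧ᵗ v)
  triple-member₂ u v w rewrite dec-true (v ≟ v) refl with does (u ≟ v)
  ... | true  = tt
  ... | false = tt

  triple-member₃ : ∀ u v w → T (⟦ u , v , w ⟧ᵗ w)
  triple-member₃ u v w rewrite dec-true (w ≟ w) refl with does (u ≟ w) | does (v ≟ w)
  ... | true  | _     = tt
  ... | false | true  = tt
  ... | false | false = tt

  triple-connected : ∀ {u v w} → Adj u v → Adj u w → Connected (Induced G ⟦ u , v , w ⟧ᵗ)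
  triple-connected {u} {v} {w} uv uw p q = toCentre p ◅◅ reverse adj-sym (toCentre q)
    where
    centre : Σ V (T ∘ ⟦ u , v , w ⟧ᵗ)
    centre = u , triple-member₁ u v w
    toCentre : ∀ p → Star (Induced G ⟦ u , v , w ⟧ᵗ) p centre
    toCentre (z , t) with triple-member t
    -- The same vertex may carry another membership proof; `T` is proof-irrelevant.
    ... | inj₁ refl = subst (λ t → Star (Induced G ⟦ u , v , w ⟧ᵗ) (u , t) centre) (T-irrelevant _ _) ε
    ... | inj₂ (inj₁ refl) = adj-sym uv ◅ ε
    ... | inj₂ (inj₂ refl) = adj-sym uw ◅ ε

  inside-boundary : ∀ X {x y} → X x ≡ X y → ¬ T (EdgeSet.mem (boundaryEdges X) x y)
  inside-boundary X {x} {y} eq t = T-xor⁻ (proj₂ (Equivalence.to (T-∧ {does (adj? x y)}) t)) eq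

  -- A vertex has at most three neighbours in X, hence at least three outside. For a vertex outside
  -- X these lie in its component; for u they show that the complement is inhabited.
  triple-restrictedCut : (∀ x → 6 ≤ degree x) → ∀ {u v w} → Adj u v → Adj u w → v ≢ w →
    Σ (RestrictedEdgeCut G 3) λ S → size G (proj₁ S) ≡ boundarySize G ⟦ u , v , w ⟧ᵗ
  triple-restrictedCut 6≤ {u} {v} {w} uv uw v≢w =
    (boundaryEdges X , disconnected , components) , size-boundaryEdges X
    where
    X : VertexSet G
    X = ⟦ u , v , w ⟧ᵗ
    u≢v : u ≢ v
    u≢v refl = irrefl uv
    u≢w : u ≢ w
    u≢w refl = irrefl uw
    outside? : ∀ x y → Dec (Adj x y × T (not (X y)))
    outside? x y = adj? x y ×-dec T? (not (X y))
    outside : V → List V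
    outside x = filter (outside? x) vertices
    3≤outside : ∀ x → 3 ≤ length (outside x)
    3≤outside x = +-cancelʳ-≤ 3 3 _ (begin
      6                                               ≤⟨ 6≤ x ⟩
      degree x                                        ≡⟨ degree-∑ x ⟩
      ∑V (α x)                                        ≤⟨ ∑-mono vertices (λ y → split (does (adj? x y)) (X y)) ⟩
      ∑V (λ y → ⟦ does (outside? x y) ⟧ + ⟦ X y ⟧)    ≡⟨ ∑-distrib-+ vertices (λ y → ⟦ does (outside? x y) ⟧) _ ⟩
      ∑V (λ y → ⟦ does (outside? x y) ⟧) + ∣ X ∣
        ≡⟨ cong₂ _+_ (sym (length-filter-∑ (outside? x) vertices)) (triple-card {X} {u} {v} {w} (isTriple u≢v u≢w v≢w)) ⟩
      length (outside x) + 3                          ∎)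
      where
      open ≤-Reasoning
      split : ∀ a b → ⟦ a ⟧ ≤ ⟦ a ∧ not b ⟧ + ⟦ b ⟧
      split = from-yes (∀Bool? λ a → ∀Bool? λ b → ⟦ a ⟧ ≤? ⟦ a ∧ not b ⟧ + ⟦ b ⟧)
    T-not⁻ : ∀ {a} → T (not a) → a ≡ false
    T-not⁻ {false} _ = refl
    T⁻ : ∀ {a} → T a → a ≡ true
    T⁻ {true} _ = refl
    outsider : ∀ xs → All (λ y → Adj u y × T (not (X y))) xs → 3 ≤ length xs → ∃ λ y → X y ≡ false
    outsider (y ∷ _) ((_ , ∉) ∷ _) _ = y , T-not⁻ ∉
    disconnected : ¬ Connected (Without G (boundaryEdges X))
    disconnected conn =
      let y , Xy = outsider (outside u) (AllP.all-filter (outside? u) vertices) (3≤outside u)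
      in contradiction (trans (sym (T⁻ (triple-member₁ u v w))) (trans (boundaryEdges-separate X (conn u y)) Xy)) λ ()
    within : ∀ {p q} → Star (Induced G X) p q → Star (Without G (boundaryEdges X)) (proj₁ p) (proj₁ q)
    within = gmap proj₁ λ {p} {q} adj → adj , inside-boundary X (trans (T⁻ (proj₂ p)) (sym (T⁻ (proj₂ q))))
    components : ComponentsAtLeast 3 (Without G (boundaryEdges X))
    components z with X z in Xz
    ... | true  = u ∷ v ∷ w ∷ []
                , (u≢v ∷ u≢w ∷ []) ∷ (v≢w ∷ []) ∷ [] ∷ []
                , reach (triple-member₁ u v w) ∷ reach (triple-member₂ u v w) ∷ reach (triple-member₃ u v w) ∷ []
                , ≤-refl
      where
      reach : ∀ {y} → T (X y) → Star (Without G (boundaryEdges X)) z y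
      reach {y} t = within (triple-connected uv uw (z , T⁺ Xz) (y , t))
    ... | false = outside z
                , filter⁺ (outside? z) unique
                , All.map (λ { (adj , ∉) → (adj , inside-boundary X (trans Xz (sym (T-not⁻ ∉)))) ◅ ε })
                    (AllP.all-filter (outside? z) vertices)
                , 3≤outside z

  -- Double-negation shift, constructive here because the vertices form a finite list.
  ¬¬-∀ : {P : V → Set} → (∀ x → ¬ ¬ P x) → ¬ ¬ (∀ x → P x)
  ¬¬-∀ {P} h k = go vertices λ all → k λ x → All.lookup all (complete x)
    where
    go : ∀ xs → ¬ ¬ All P xs
    go []       k = k []
    go (x ∷ xs) k = h x λ p → go xs λ ps → k (p ∷ ps)

  -- Reachability in G - S is only needed up to double negation, the conclusion being decidable.
  restrictedCut-bound : ∀ {k} → (∀ X → 3 ≤ ∣ X ∣ → 3 ≤ ∣ complement X ∣ → k ≤ boundarySize G X) →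
    ∀ (S : RestrictedEdgeCut G 3) → k ≤ size G (proj₁ S)
  restrictedCut-bound {k} bound (S , ¬conn , comps) = decidable-stable (k ≤? size G S) λ ≰size →
    ¬¬-∀ (λ x → ¬¬-∀ λ y → ¬¬-excluded-middle) λ reach? →
      ¬conn λ x y → decidable-stable (reach? x y) λ ¬xy → ≰size (cut reach? x y ¬xy)
    where
    R : V → V → Set
    R = Star (Without G S)
    R-sym : ∀ {x y} → R x y → R y x
    R-sym = reverse λ { (adj , ∉) → adj-sym adj , ∉ ∘ EdgeSet.mem-sym S }
    cut : (∀ x y → Dec (R x y)) → ∀ x y → ¬ R x y → k ≤ size G S
    cut reach? x y ¬xy = ≤-trans
      (bound X (large X x λ r → reached r) (large (complement X) y λ r → unreached r))
      (*-cancelˡ-≤ 2 2∂≤2S)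
      where
      -- The component of x. Its complement contains the component of y, so both have at least three
      -- vertices, and an edge leaving X lies in S, or its outer end would be reachable.
      X : VertexSet G
      X z = does (reach? x z)
      reached : ∀ {z} → R x z → T (X z)
      reached {z} r rewrite dec-true (reach? x z) r = tt
      unreached : ∀ {z} → R y z → T (not (X z))
      unreached {z} r rewrite dec-false (reach? x z) (λ xz → ¬xy (xz ◅◅ R-sym r)) = tt
      large : ∀ Y z → (∀ {w} → R z w → T (Y w)) → 3 ≤ ∣ Y ∣
      large Y z sub with comps z
      ... | xs , distinct , all , 3≤ = ≤-trans 3≤
        (unique-length≤ _≟_ Y distinct complete unique (All.map sub all))
      r : V → V → Bool
      r = EdgeSet.mem S
      r-sym : ∀ a b → r a b ≡ r b a
      r-sym a b = does-cong (T? (r a b)) (T? (r b a)) (EdgeSet.mem-sym S) (EdgeSet.mem-sym S)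
      r-irrefl : ∀ a → r a a ≡ false
      r-irrefl a = dec-false (T? (r a a)) (irrefl ∘ EdgeSet.mem-adj S)
      crossing : ∀ a b → α a b * ⟦ X a xor X b ⟧ ≤ ⟦ r a b ⟧
      crossing a b with adj? a b | r a b in mem | reach? x a | reach? x b
      ... | no _    | _     | _      | _      = z≤n
      ... | yes _   | true  | yes _  | yes _  = z≤n
      ... | yes _   | true  | yes _  | no _   = ≤-refl
      ... | yes _   | true  | no _   | yes _  = ≤-refl
      ... | yes _   | true  | no _   | no _   = z≤n
      ... | yes _   | false | yes _  | yes _  = z≤n
      ... | yes _   | false | no _   | no _   = z≤n
      ... | yes adj | false | yes xa | no ¬xb =
        ⊥-elim (¬xb (xa ◅◅ (adj , subst T mem) ◅ ε))
      ... | yes adj | false | no ¬xa | yes xb =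
        ⊥-elim (¬xa (xb ◅◅ (adj-sym adj , subst T mem ∘ EdgeSet.mem-sym S) ◅ ε))
      2∂≤2S : 2 * boundarySize G X ≤ 2 * size G S
      2∂≤2S = begin
        2 * boundarySize G X                        ≡⟨ boundary-D X ⟩
        D X X                                       ≤⟨ ∑-mono vertices (λ a → ∑-mono vertices (crossing a)) ⟩
        ∑V (λ a → ∑V λ b → ⟦ r a b ⟧)               ≡⟨ ∑-pairs vertices r r-irrefl r-sym ⟩
        2 * ∑ (pairs vertices) (λ p → ⟦ uncurry r p ⟧)
          ≡⟨ cong (2 *_) (sym (length-filter-∑ (uncurry λ a b → T? (r a b)) (pairs vertices))) ⟩
        2 * size G S ∎
        where open ≤-Reasoning

IsMinimum-unique : ∀ {f : A → ℕ} {j k} → IsMinimum f j → IsMinimum f k → j ≡ k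
IsMinimum-unique ((a , fa≡j) , j≤) ((b , fb≡k) , k≤) =
  ≤-antisym (subst (_ ≤_) fb≡k (j≤ b)) (subst (_ ≤_) fa≡j (k≤ a))

-- Three-vertex sets in the product

module ThreeSets (G : Graph) (d : ℕ) (d≤degree : ∀ x → d ≤ Graph.degree G x) (2≤d : 2 ≤ d)
  (m : ℕ) (4≤n : 4 ≤ suc m) where
  open Graph G using (V; Adj; adj?; degree; vertices)
  open Product G m (<⇒≤ 4≤n)
  open Triples K

  -- Three steps without wrapping only increase; one wrap forces n = 3, two consecutive wraps force
  -- n = 1. The remaining cases are rotations of these.
  Next-triangleFree : ∀ {a b c} → Next n a b → Next n b c → ¬ Next n c a
  Next-triangleFree {a} (inj₁ p) (inj₁ q) (inj₁ r) =
    <-irrefl (trans r (cong suc (trans q (cong suc p)))) (s≤s (m≤n+m (toℕ a) 2))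
  Next-triangleFree (inj₁ p) (inj₁ q) (inj₂ (r , s)) =
    <-irrefl (trans (cong suc (sym (trans q (cong suc (trans p (cong suc s)))))) r) 4≤n
  Next-triangleFree p@(inj₁ _) q@(inj₂ _) r@(inj₁ _) = Next-triangleFree r p q
  Next-triangleFree p@(inj₂ _) q@(inj₁ _) r@(inj₁ _) = Next-triangleFree q r p
  Next-triangleFree (inj₂ (p , q)) (inj₂ (r , s)) _ =
    <-irrefl (trans (sym (cong suc q)) r) (≤-trans (s≤s (s≤s z≤n)) 4≤n)
  Next-triangleFree p@(inj₂ _) q@(inj₁ _) r@(inj₂ _) = Next-triangleFree r p q
  Next-triangleFree p@(inj₁ _) q@(inj₂ _) r@(inj₂ _) = Next-triangleFree q r p

  Next-functional : ∀ {a b c} → Next n a b → Next n a c → b ≡ c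
  Next-functional p q = trans (Next-unique p) (sym (Next-unique q))

  -- Orient the edges along `Next`. Two of them with a common source or a common target coincide, so
  -- a triangle would be a directed one.
  cycle-triangleFree : ∀ {a b c} → Graph.Adj C a b → Graph.Adj C a c → ¬ Graph.Adj C b c
  cycle-triangleFree {b = b} {c} (inj₁ p) (inj₁ q) bc with refl ← Next-functional p q = Graph.irrefl C {b} bc
  cycle-triangleFree {b = b} {c} (inj₂ p) (inj₂ q) bc with refl ← Next-injective p q = Graph.irrefl C {b} bc
  cycle-triangleFree (inj₁ p) (inj₂ q) (inj₁ r) = Next-triangleFree p r q
  cycle-triangleFree {a} (inj₁ p) (inj₂ q) (inj₂ r) with refl ← Next-functional q r = Graph.irrefl C {a} (inj₁ p)
  cycle-triangleFree {a} (inj₂ p) (inj₁ q) (inj₁ r) with refl ← Next-functional p r = Graph.irrefl C {a} (inj₁ q)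
  cycle-triangleFree (inj₂ p) (inj₁ q) (inj₂ r) = Next-triangleFree q r p

  -- A decidable equivalent of ξ(G) = 2d - 2, by `minEdge⇒` and `minEdge⇐`.
  MinEdge : Set
  MinEdge = ∃₂ λ x x′ → Adj x x′ × degree x ≡ d × degree x′ ≡ d

  minEdge? : Dec MinEdge
  minEdge? = map′ (λ a → let x , b = Any.satisfied a ; x′ , p = Any.satisfied b in x , x′ , p)
    (λ (x , x′ , p) → lose (Graph.complete G x) (lose (Graph.complete G x′) p))
    (Any.any? (λ x → Any.any? (λ x′ → adj? x x′ ×-dec degree x ≟ⁿ d ×-dec degree x′ ≟ⁿ d) vertices) vertices)

  minEdge⇒ : MinEdge → IsMinEdgeDegree G (2 * d ∸ 2)
  minEdge⇒ (x , x′ , adj , p , q) =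
      ((x , x′ , adj) , cong (_∸ 2) (trans (cong₂ _+_ p q) (cong (d +_) (sym (+-identityʳ d)))))
    , λ (u , v , _) → ∸-monoˡ-≤ 2 (+-mono-≤ (d≤degree u) (≤-trans (≤-reflexive (+-identityʳ d)) (d≤degree v)))

  minEdge⇐ : IsMinEdgeDegree G (2 * d ∸ 2) → MinEdge
  minEdge⇐ (((x , x′ , adj) , eq) , _) = x , x′ , adj , tight (d≤degree x) (d≤degree x′) sum≤
    , tight (d≤degree x′) (d≤degree x) (≤-trans (≤-reflexive (+-comm (degree x′) (degree x))) sum≤)
    where
    sum≤ : degree x + degree x′ ≤ 2 * d
    sum≤ = ≤-trans (m≤n+m∸n (degree x + degree x′) 2) (≤-trans (≤-reflexive (cong (2 +_) eq))
      -- Since 2 ≤ 2d, the truncated 2d - 2 loses nothing.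
      (≤-reflexive (m+[n∸m]≡n (≤-trans 2≤d (m≤m+n d _)))))
    tight : ∀ {i j} → d ≤ i → d ≤ j → i + j ≤ 2 * d → i ≡ d
    tight {i} {j} d≤i d≤j le = ≤-antisym (linear 0 (+-mono-≤ d≤j le) (identity i j d)) d≤i
      where
      identity : ∀ i j d → i + (j + 2 * d) + 0 ≡ d + (d + (i + j))
      identity = solve-∀

  triple-degrees : ∀ {X u v w} → IsTriple X u v w →
    boundarySize K X + 2 * (K.α u v + (K.α u w + K.α v w))
      ≡ 3 * (degree (proj₁ u) + (degree (proj₁ v) + degree (proj₁ w))) + 6
  triple-degrees {X} {u} {v} {w} t = trans (triple-boundary {X} {u} {v} {w} t)
    (trans (cong₂ _+_ (degree-K (proj₁ u) (proj₂ u))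
        (cong₂ _+_ (degree-K (proj₁ v) (proj₂ v)) (degree-K (proj₁ w) (proj₂ w))))
      (eq (degree (proj₁ u)) (degree (proj₁ v)) (degree (proj₁ w))))
    where
    eq : ∀ a b c → 3 * a + 2 + (3 * b + 2 + (3 * c + 2)) ≡ 3 * (a + (b + c)) + 6
    eq = solve-∀

  -- As C is triangle-free, a triangle of K projects onto an edge of G.
  triangle-edge : ∀ {u v w} → Graph.Adj K u v → Graph.Adj K u w → Graph.Adj K v w →
    (∀ {z} → z ≡ u ⊎ z ≡ v ⊎ z ≡ w → degree (proj₁ z) ≡ d) → MinEdge
  triangle-edge uv uw vw deg with edge uv | edge uw | edge vw
    where
    edge : ∀ {p q} → Graph.Adj K p q → Adj (proj₁ p) (proj₁ q) ⊎ Graph.Adj C (proj₂ p) (proj₂ q)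
    edge (inj₁ (_ , b))        = inj₂ b
    edge (inj₂ (inj₁ (_ , a))) = inj₁ a
    edge (inj₂ (inj₂ (a , _))) = inj₁ a
  ... | inj₁ a | _ | _ = _ , _ , a , deg (inj₁ refl) , deg (inj₂ (inj₁ refl))
  ... | _ | inj₁ a | _ = _ , _ , a , deg (inj₁ refl) , deg (inj₂ (inj₂ refl))
  ... | _ | _ | inj₁ a = _ , _ , a , deg (inj₂ (inj₁ refl)) , deg (inj₂ (inj₂ refl))
  ... | inj₂ p | inj₂ q | inj₂ r = ⊥-elim (cycle-triangleFree p q r)

  -- With s the sum of the three degrees in G, the boundary has 3s + 6 edges minus twice those
  -- inside. At most two inner edges give 9d + 2. A triangle gives 3s, which is at least 9d + 3
  -- unless all three degrees equal d.
  triple-bounds : ∀ X → K.∣ X ∣ ≡ 3 → 9 * d ≤ boundarySize K X × (¬ MinEdge → 9 * d + 2 ≤ boundarySize K X)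
  triple-bounds X 3≡ with three-triple X 3≡
  ... | u , v , w , t = split (adjK? u v ×-dec adjK? u w ×-dec adjK? v w)
    where
    open Graph K using () renaming (Adj to AdjK; adj? to adjK?)
    b i j k : ℕ
    b = boundarySize K X
    i = degree (proj₁ u)
    j = degree (proj₁ v)
    k = degree (proj₁ w)
    3d≤ : d + (d + d) ≤ i + (j + k)
    3d≤ = +-mono-≤ (d≤degree _) (+-mono-≤ (d≤degree _) (d≤degree _))
    degrees : b + 2 * (K.α u v + (K.α u w + K.α v w)) ≡ 3 * (i + (j + k)) + 6
    degrees = triple-degrees {X} {u} {v} {w} t
    split : Dec (AdjK u v × AdjK u w × AdjK v w) → 9 * d ≤ b × (¬ MinEdge → 9 * d + 2 ≤ b)
    split (no ¬triangle) = ≤-trans (m≤m+n (9 * d) 2) bound , λ _ → bound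
      where
      bound : 9 * d + 2 ≤ b
      bound = linear 0 (+-mono-≤ (*-monoʳ-≤ 3 3d≤) (+-mono-≤ (*-monoʳ-≤ 2 (nonTriangle-edges ¬triangle)) (≤-reflexive (sym degrees))))
        (eq d b (3 * (i + (j + k))) (2 * (K.α u v + (K.α u w + K.α v w))))
        where
        eq : ∀ d b s a → 9 * d + 2 + (s + (2 * 2 + (b + a))) + 0 ≡ b + (3 * (d + (d + d)) + (a + (s + 6)))
        eq = solve-∀
    split (yes (uv , uw , vw)) = ≤-trans (≤-trans (≤-reflexive (nine d)) (*-monoʳ-≤ 3 3d≤)) (≤-reflexive (sym b≡)) , strict
      where
      nine : ∀ d → 9 * d ≡ 3 * (d + (d + d))
      nine = solve-∀
      b≡ : b ≡ 3 * (i + (j + k))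
      b≡ = +-cancelʳ-≡ 6 _ _ (trans (cong (λ a → b + 2 * a) (sym
        (cong₂ _+_ (α-adjacent uv) (cong₂ _+_ (α-adjacent uw) (α-adjacent vw))))) degrees)
      strict : ¬ MinEdge → 9 * d + 2 ≤ b
      strict ¬minEdge with d + (d + d) <? i + (j + k)
      ... | yes lt = ≤-trans (linear 1 (*-monoʳ-≤ 3 lt) (eq d (i + (j + k)))) (≤-reflexive (sym b≡))
        where
        eq : ∀ d s → 9 * d + 2 + 3 * s + 1 ≡ 3 * s + 3 * suc (d + (d + d))
        eq = solve-∀
      ... | no ≮ = ⊥-elim (¬minEdge (triangle-edge uv uw vw λ
          { (inj₁ refl)        → ≤-antisym (linear 0 (+-mono-≤ (+-mono-≤ (d≤degree _) (d≤degree _)) (≮⇒≥ ≮)) (eq₁ i j k d)) (d≤degree _)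
          ; (inj₂ (inj₁ refl)) → ≤-antisym (linear 0 (+-mono-≤ (+-mono-≤ (d≤degree _) (d≤degree _)) (≮⇒≥ ≮)) (eq₂ i j k d)) (d≤degree _)
          ; (inj₂ (inj₂ refl)) → ≤-antisym (linear 0 (+-mono-≤ (+-mono-≤ (d≤degree _) (d≤degree _)) (≮⇒≥ ≮)) (eq₃ i j k d)) (d≤degree _) }))
        where
        eq₁ : ∀ i j k d → i + (j + k + (d + (d + d))) + 0 ≡ d + (d + d + (i + (j + k)))
        eq₁ = solve-∀
        eq₂ : ∀ i j k d → j + (i + k + (d + (d + d))) + 0 ≡ d + (d + d + (i + (j + k)))
        eq₂ = solve-∀
        eq₃ : ∀ i j k d → k + (i + j + (d + (d + d))) + 0 ≡ d + (d + d + (i + (j + k)))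
        eq₃ = solve-∀

  distinct : ∀ {u v w} → Graph.Adj K u v → Graph.Adj K u w → v ≢ w → IsTriple ⟦ u , v , w ⟧ᵗ u v w
  distinct {u} uv uw v≢w = isTriple (λ { refl → Graph.irrefl K {u} uv }) (λ { refl → Graph.irrefl K {u} uw }) v≢w

  -- A single triple serves both invariants: its boundary is the cut for `Isλ₃`, and the triple
  -- itself is the set for `Isξ₃`.
  Attained : ℕ → Set
  Attained k = (∃ λ (S : RestrictedEdgeCut K 3) → size K (proj₁ S) ≡ k)
             × (∃ λ (X : ConnectedSet K 3) → boundarySize K (proj₁ X) ≡ k)

  triple-attained : ∀ {u v w} → Graph.Adj K u v → Graph.Adj K u w → v ≢ w →
    Attained (boundarySize K ⟦ u , v , w ⟧ᵗ)
  triple-attained {u} {v} {w} uv uw v≢w =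
      triple-restrictedCut 6≤ uv uw v≢w
    , (⟦ u , v , w ⟧ᵗ , trans (K.card-∑ _) (triple-card {⟦ u , v , w ⟧ᵗ} {u} {v} {w} (distinct uv uw v≢w)) , triple-connected uv uw) , refl
    where
    6≤ : ∀ p → 6 ≤ Graph.degree K p
    6≤ (x , y) = ≤-trans (+-monoˡ-≤ 2 (≤-trans (m≤n+m 4 2) (*-monoʳ-≤ 3 (≤-trans 2≤d (d≤degree x))))) (≤-reflexive (sym (degree-K x y)))

  attained-edge : MinEdge → Attained (9 * d)
  attained-edge (x , x′ , adj , p , q) = subst Attained boundary (triple-attained uv uw v≢w)
    where
    y : Fin n
    y = zero
    u v w : V × Fin n
    u = x , y
    v = x , next y
    w = x′ , y
    uv : Graph.Adj K u v
    uv = inj₁ (refl , inj₁ (Next-next y))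
    uw : Graph.Adj K u w
    uw = inj₂ (inj₁ (refl , adj))
    vw : Graph.Adj K v w
    vw = inj₂ (inj₂ (adj , inj₂ (Next-next y)))
    v≢w : v ≢ w
    v≢w eq = Graph.irrefl G (subst (Adj x) (sym (cong proj₁ eq)) adj)
    boundary : boundarySize K ⟦ u , v , w ⟧ᵗ ≡ 9 * d
    -- The 6 is twice the number of edges of the triangle.
    boundary = +-cancelʳ-≡ 6 _ _ (begin
      boundarySize K ⟦ u , v , w ⟧ᵗ + 6
        ≡⟨ cong (λ a → boundarySize K ⟦ u , v , w ⟧ᵗ + 2 * a)
             (cong₂ _+_ (α-adjacent uv) (cong₂ _+_ (α-adjacent uw) (α-adjacent vw))) ⟨
      boundarySize K ⟦ u , v , w ⟧ᵗ + 2 * (K.α u v + (K.α u w + K.α v w))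
        ≡⟨ triple-degrees {⟦ u , v , w ⟧ᵗ} {u} {v} {w} (distinct uv uw v≢w) ⟩
      3 * (degree x + (degree x + degree x′)) + 6
        ≡⟨ cong₂ (λ i j → 3 * (i + (i + j)) + 6) p q ⟩
      3 * (d + (d + d)) + 6
        ≡⟨ eq d ⟩
      9 * d + 6 ∎)
      where
      open ≡-Reasoning
      eq : ∀ d → 3 * (d + (d + d)) + 6 ≡ 9 * d + 6
      eq = solve-∀

  -- The witness is a path in the fibre over x; its ends are not adjacent because the cycle has no
  -- triangle.
  attained-vertex : ∀ x → degree x ≡ d → Attained (9 * d + 2)
  attained-vertex x p = subst Attained boundary (triple-attained uv uw v≢w)
    where
    y : Fin n
    y = zero
    u v w : V × Fin n
    u = x , y
    v = x , next y
    w = x , prev y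
    uv : Graph.Adj K u v
    uv = inj₁ (refl , inj₁ (Next-next y))
    uw : Graph.Adj K u w
    uw = inj₁ (refl , inj₂ (Next-prev y))
    v≢w : v ≢ w
    v≢w eq = Next-asym (Next-next y) (subst (λ z → Next n z y) (sym (cong proj₂ eq)) (Next-prev y))
    ¬vw : ¬ Graph.Adj K v w
    ¬vw (inj₁ (_ , a))        = cycle-triangleFree (inj₁ (Next-next y)) (inj₂ (Next-prev y)) a
    ¬vw (inj₂ (inj₁ (_ , a))) = Graph.irrefl G a
    ¬vw (inj₂ (inj₂ (a , _))) = Graph.irrefl G a
    boundary : boundarySize K ⟦ u , v , w ⟧ᵗ ≡ 9 * d + 2
    -- Only two inner edges here, hence 4.
    boundary = +-cancelʳ-≡ 4 _ _ (begin
      boundarySize K ⟦ u , v , w ⟧ᵗ + 4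
        ≡⟨ cong (λ a → boundarySize K ⟦ u , v , w ⟧ᵗ + 2 * a)
             (cong₂ _+_ (α-adjacent uv) (cong₂ _+_ (α-adjacent uw) (α-nonadjacent ¬vw))) ⟨
      boundarySize K ⟦ u , v , w ⟧ᵗ + 2 * (K.α u v + (K.α u w + K.α v w))
        ≡⟨ triple-degrees {⟦ u , v , w ⟧ᵗ} {u} {v} {w} (distinct uv uw v≢w) ⟩
      3 * (degree x + (degree x + degree x)) + 6
        ≡⟨ cong (λ i → 3 * (i + (i + i)) + 6) p ⟩
      3 * (d + (d + d)) + 6
        ≡⟨ eq d ⟩
      9 * d + 2 + 4 ∎)
      where
      open ≡-Reasoning
      eq : ∀ d → 3 * (d + (d + d)) + 6 ≡ 9 * d + 2 + 4
      eq = solve-∀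

-- Both invariants of the product

theorem3p1 : (G : Graph) (d n : ℕ) → MaximallyEdgeConnected G → 5 ≤ Graph.order G →
  IsMinDegree G d → 2 ≤ d → (4≤n : 4 ≤ n) →
  let K = G ⊠ cycle n (<⇒≤ 4≤n) in
  (IsMinEdgeDegree G (2 * d ∸ 2) → Isλ₃ K [ 9 * d ] × Isξ₃ K (9 * d)) ×
  (¬ IsMinEdgeDegree G (2 * d ∸ 2) → Isλ₃ K [ 9 * d + 2 ] × Isξ₃ K (9 * d + 2)) ×
  Maximally3RestrictedEdgeConnected K
theorem3p1 G d (suc m) (k , edgeConn , minDeg) 5≤order isMin@((x₀ , x₀-min) , d≤degree) 2≤d 4≤n =
    (λ h → minima (m≤m+n (9 * d) 2) (attained-edge (minEdge⇐ h)) λ X 3≡ → proj₁ (triple-bounds X 3≡))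
  , (λ h → minima ≤-refl (attained-vertex x₀ x₀-min) λ X 3≡ → proj₂ (triple-bounds X 3≡) (h ∘ minEdge⇒))
  , either minEdge?
  where
  open ThreeSets G d d≤degree 2≤d m 4≤n
  open Product G m (<⇒≤ 4≤n) using (K; module K)
  d≤order : d ≤ Graph.order G
  d≤order = ≤-trans (d≤degree x₀) (length-filter (Graph.adj? G x₀) (Graph.vertices G))
  -- Maximal edge-connectivity comes with its own minimum degree k, identified with d by uniqueness
  -- of minima.
  d≤boundary : ∀ A {x y} → A x ≡ true → A y ≡ false → d ≤ boundarySize G A
  d≤boundary = Counting.connectivity≤boundary G
    (subst (IsEdgeConnectivity G) (IsMinimum-unique minDeg isMin) edgeConn)
  open LowerBound G d d≤degree d≤boundary 2≤d d≤order 5≤order m 4≤n using (largeSet-bound)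
  minima : ∀ {k} → k ≤ 9 * d + 2 → Attained k → (∀ X → K.∣ X ∣ ≡ 3 → k ≤ boundarySize K X) → Isλ₃ K [ k ] × Isξ₃ K k
  minima {k} k≤ (cut , set) three = (cut , Triples.restrictedCut-bound K bound)
    , (set , λ (X , 3≡ , _) → three X (trans (sym (K.card-∑ X)) 3≡))
    where
    bound : ∀ X → 3 ≤ K.∣ X ∣ → 3 ≤ K.∣ complement X ∣ → k ≤ boundarySize K X
    -- Either both sides have four vertices, or one of them is a triple with the same boundary.
    bound X 3≤ 3≤′ with m≤n⇒m<n∨m≡n 3≤ | m≤n⇒m<n∨m≡n 3≤′
    ... | inj₁ 4≤ | inj₁ 4≤′ = ≤-trans k≤ (largeSet-bound X 4≤ 4≤′)
    ... | inj₂ 3≡ | _        = three X (sym 3≡)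
    ... | inj₁ _  | inj₂ 3≡  = subst (k ≤_) (K.boundary-complement X) (three (complement X) (sym 3≡))
  -- The last conclusion assumes nothing about ξ(G), so the case is decided by `minEdge?`.
  either : Dec MinEdge → Maximally3RestrictedEdgeConnected K
  either (yes h) = 9 * d , minima (m≤m+n (9 * d) 2) (attained-edge h) λ X 3≡ → proj₁ (triple-bounds X 3≡)
  either (no ¬h) = 9 * d + 2 , minima ≤-refl (attained-vertex x₀ x₀-min) λ X 3≡ → proj₂ (triple-bounds X 3≡) ¬h
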